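{- Let $f\in\mathbb{R}[x_1,\ldots,x_n]$ be a homogeneous polynomial of degree $d\ge 3$, and let $\mathscr{C}$ be an open, convex and effective cone in $\mathbb{R}^n$, with lineality space $L_{\mathscr{C}}$. Suppose that (1) $f(\mathbf{x}+\mathbf{w})=f(\mathbf{x})$ for all $\mathbf{x}\in\mathbb{R}^n$ and $\mathbf{w}\in L_{\mathscr{C}}$; (2) $D_{\mathbf{v}_1}\cdots D_{\mathbf{v}_d}f>0$ for all $\mathbf{v}_1,\ldots,\mathbf{v}_d\in\mathscr{C}$; (3) for all $\mathbf{v}_1,\ldots,\mathbf{v}_{d-2}\in\mathscr{C}$, the Hessian of the quadratic polynomial $D_{\mathbf{v}_1}\cdots D_{\mathbf{v}_{d-2}}f$ is irreducible and its off-diagonal entries are nonnegative; (4) $\partial_i f$ is $\mathscr{C}$-Lorentzian for every $i\in\{1,\ldots,n\}$. Then $f$ is $\mathscr{C}$-Lorentzian.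
   Context: Notation: $\partial_i=\partial/\partial x_i$, and for $\mathbf{u}=(u_1,\ldots,u_n)\in\mathbb{R}^n$, $D_{\mathbf{u}}=u_1\partial_1+\cdots+u_n\partial_n$. The Hessian of $g$ at $\mathbf{x}$ is the matrix $(\partial_i\partial_j g(\mathbf{x}))_{i,j=1}^n$; for a quadratic polynomial it is a constant matrix. $\mathscr{C}$-Lorentzian: let $\mathscr{C}$ be an open convex cone in $\mathbb{R}^n$. A homogeneous polynomial $g\in\mathbb{R}[x_1,\ldots,x_n]$ of degree $d$ is $\mathscr{C}$-Lorentzian if for all $\mathbf{v}_1,\ldots,\mathbf{v}_d\in\mathscr{C}$: (P) $D_{\mathbf{v}_1}\cdots D_{\mathbf{v}_d}g>0$, and (H) the symmetric bilinear form $(\mathbf{x},\mathbf{y})\mapsto D_{\mathbf{x}}D_{\mathbf{y}}D_{\mathbf{v}_3}\cdots D_{\mathbf{v}_d}g$ has exactly one positive eigenvalue, counted with multiplicity (condition (H) is vacuous if $d\le 1$). By convention the identically zero polynomial is also $\mathscr{C}$-Lorentzian. Irreducible: a matrix $A=(a_{ij})_{i,j=1}^n$ with nonnegative off-diagonal entries is irreducible if for all distinct $i,j$ there is a sequence $i=i_0,i_1,\ldots,i_\ell=j$ with $i_{k-1}\ne i_k$ for all $1\le k\le\ell$ and $a_{i_0i_1}a_{i_1i_2}\cdots a_{i_{\ell-1}i_\ell}>0$. Lineality space: $L_{\mathscr{C}}=\overline{\mathscr{C}}\cap(-\overline{\mathscr{C}})$. Effective: $\mathscr{C}$ is effective if $\mathscr{C}=(\mathscr{C}\cap\mathbb{R}_{>0}^n)+L_{\mathscr{C}}$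 (Minkowski sum). -}

module Defs where

open import Level using (0ℓ)
open import Algebra.Bundles using (CommutativeRing; Semiring)
open import Data.Bool.Base using (if_then_else_)
open import Data.Fin.Base using (Fin; zero; suc; inject₁; fromℕ)
open import Data.Fin.Properties using () renaming (_≟_ to _≟ᶠ_)
open import Data.List.Base as List using (List; []; _∷_)
open import Data.Nat.Base as ℕ using (ℕ; zero; suc)
open import Data.Nat.Properties using () renaming (_≟_ to _≟ⁿ_)
open import Data.Product.Base using (_×_; _,_; ∃; ∃-syntax; Σ-syntax)
open import Data.Sum.Base using (_⊎_)
open import Data.Unit.Base using (⊤)
open import Data.Vec.Base as Vec using (Vec; _[_]%=_)
open import Data.Vec.Functional as Vector using (Vector)
open import Data.Vec.Properties using (≡-dec)
open import Function.Bundles using (_⇔_)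
open import Relation.Binary.Core using (Rel)
open import Relation.Binary.Structures using (IsStrictTotalOrder)
open import Relation.Binary.PropositionalEquality using (_≡_; _≢_)
open import Relation.Nullary.Decidable using (⌊_⌋)
open import Relation.Nullary.Negation using (¬_)
open import Relation.Unary using (Pred)

import Algebra.Definitions.RawSemiring as RawSemiringOps
import Relation.Binary.Construct.StrictToNonStrict as StrictToNonStrict

-- The real numbers, presented by the axioms that characterise them up to
-- isomorphism: a totally ordered field with the least upper bound property.
-- Equality is a setoid equality, so that ℝ may be a type of representatives.

record CompleteOrderedField : Set₁ where
  infix 4 _<_
  field
    commutativeRing : CommutativeRing 0ℓ 0ℓ

  open CommutativeRing commutativeRing public

  field
    _<_                : Rel Carrier 0ℓ
    isStrictTotalOrder : IsStrictTotalOrder _≈_ _<_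
    0≉1                : ¬ (0# ≈ 1#)
    inverse            : ∀ x → ¬ (x ≈ 0#) → ∃[ y ] x * y ≈ 1#
    +-monoˡ-<          : ∀ {x y} z → x < y → x + z < y + z
    *-pos              : ∀ {x y} → 0# < x → 0# < y → 0# < x * y

  open StrictToNonStrict _≈_ _<_ public using (_≤_)

  IsUpperBound : Pred Carrier 0ℓ → Carrier → Set
  IsUpperBound S b = ∀ x → S x → x ≤ b

  field
    supremum : ∀ (S : Pred Carrier 0ℓ) → ∃ S → ∃ (IsUpperBound S) →
               ∃[ s ] IsUpperBound S s × (∀ b → IsUpperBound S b → s ≤ b)

module Lorentzian (𝕜 : CompleteOrderedField) where

  open CompleteOrderedField 𝕜 public
    using (_≈_; _+_; _*_; -_; _-_; 0#; 1#; _<_; _≤_; semiring)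
    renaming (Carrier to ℝ)
  open RawSemiringOps (Semiring.rawSemiring semiring)
    using (sum; product; _^_) renaming (_×_ to _·_)

  ℝ^ : ℕ → Set
  ℝ^ n = Vector ℝ n

  Matrix : ℕ → Set
  Matrix n = Fin n → Fin n → ℝ

  module _ {n : ℕ} where

    infix  4 _≋_
    infixl 6 _⊕_
    infixr 7 _⊙_

    _≋_ : Rel (ℝ^ n) 0ℓ
    u ≋ v = ∀ i → u i ≈ v i

    0⃗ : ℝ^ n
    0⃗ _ = 0#

    _⊕_ : ℝ^ n → ℝ^ n → ℝ^ n
    (u ⊕ v) i = u i + v i

    _⊙_ : ℝ → ℝ^ n → ℝ^ n
    (t ⊙ u) i = t * u i

    ⊖_ : ℝ^ n → ℝ^ n
    (⊖ u) i = - u i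

    basis : Fin n → ℝ^ n
    basis i j = if ⌊ i ≟ᶠ j ⌋ then 1# else 0#

    Positive : ℝ^ n → Set
    Positive u = ∀ i → 0# < u i

    _*ᵥ_ : Matrix n → ℝ^ n → ℝ^ n
    (M *ᵥ u) i = sum (λ j → M i j * u j)

    IsEigenvector : Matrix n → ℝ → ℝ^ n → Set
    IsEigenvector M μ u = ¬ (u ≋ 0⃗) × (M *ᵥ u) ≋ (μ ⊙ u)

    -- To be used for symmetric matrices only, where the multiplicity of an
    -- eigenvalue is the dimension of its eigenspace.

    record ExactlyOnePositiveEigenvalue (M : Matrix n) : Set where
      field
        eigenvalue   : ℝ
        positive     : 0# < eigenvalue
        eigenvector  : ℝ^ n
        isEigen      : IsEigenvector M eigenvalue eigenvector
        unique       : ∀ μ u → 0# < μ → IsEigenvector M μ u → μ ≈ eigenvalue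
        multiplicity : ∀ u → IsEigenvector M eigenvalue u →
                       ∃[ t ] u ≋ t ⊙ eigenvector

    -- The eigenvalues of a bilinear form are those of its matrix in the
    -- standard basis.

    gram : (ℝ^ n → ℝ^ n → ℝ) → Matrix n
    gram B i j = B (basis i) (basis j)

    NonnegativeOffDiagonal : Matrix n → Set
    NonnegativeOffDiagonal A = ∀ i j → i ≢ j → 0# ≤ A i j

    Irreducible : Matrix n → Set
    Irreducible A =
      ∀ i j → i ≢ j →
      ∃[ ℓ ] Σ[ s ∈ Vector (Fin n) (suc ℓ) ]
        s zero ≡ i
        × s (fromℕ ℓ) ≡ j
        × (∀ (k : Fin ℓ) → s (inject₁ k) ≢ s (suc k))
        × 0# < product (λ (k : Fin ℓ) → A (s (inject₁ k)) (s (suc k)))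

    -- y lies in the open ε-ball around x for the sup norm.

    Near : ℝ → ℝ^ n → ℝ^ n → Set
    Near ε x y = ∀ i → x i - ε < y i × y i < x i + ε

    IsOpen : Pred (ℝ^ n) 0ℓ → Set
    IsOpen C = ∀ x → C x → ∃[ ε ] 0# < ε × (∀ y → Near ε x y → C y)

    Closure : Pred (ℝ^ n) 0ℓ → Pred (ℝ^ n) 0ℓ
    Closure C x = ∀ ε → 0# < ε → ∃[ y ] C y × Near ε x y

    IsConvex : Pred (ℝ^ n) 0ℓ → Set
    IsConvex C = ∀ x y t → C x → C y → 0# ≤ t → t ≤ 1# →
                 C ((t ⊙ x) ⊕ ((1# - t) ⊙ y))

    IsCone : Pred (ℝ^ n) 0ℓ → Set
    IsCone C = ∀ x t → C x → 0# < t → C (t ⊙ x)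

    record IsOpenConvexCone (C : Pred (ℝ^ n) 0ℓ) : Set where
      field
        isOpen   : IsOpen C
        isConvex : IsConvex C
        isCone   : IsCone C

    Lineality : Pred (ℝ^ n) 0ℓ → Pred (ℝ^ n) 0ℓ
    Lineality C x = Closure C x × Closure C (⊖ x)

    Effective : Pred (ℝ^ n) 0ℓ → Set
    Effective C =
      ∀ x → C x ⇔ (∃[ p ] ∃[ w ] (C p × Positive p) × Lineality C w × x ≋ p ⊕ w)

  Exponent : ℕ → Set
  Exponent n = Vec ℕ n

  -- A polynomial is a formal sum of terms c x₁^α₁⋯xₙ^αₙ, in which exponents may
  -- repeat and coefficients may vanish; `coeff` collects like terms.

  Poly : ℕ → Set
  Poly n = List (ℝ × Exponent n)

  module _ {n : ℕ} where

    coeff : Poly n → Exponent n → ℝ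
    coeff []            β = 0#
    coeff ((c , α) ∷ p) β =
      (if ⌊ ≡-dec _≟ⁿ_ α β ⌋ then c else 0#) + coeff p β

    IsZero : Poly n → Set
    IsZero p = ∀ α → coeff p α ≈ 0#

    Homogeneous : ℕ → Poly n → Set
    Homogeneous d p = ∀ α → Vec.sum α ≢ d → coeff p α ≈ 0#

    ⟦_⟧ : Poly n → ℝ^ n → ℝ
    ⟦ [] ⟧          x = 0#
    ⟦ (c , α) ∷ p ⟧ x = c * product (λ i → x i ^ Vec.lookup α i) + ⟦ p ⟧ x

    infixr 7 _∙_
    _∙_ : ℝ → Poly n → Poly n
    t ∙ p = List.map (λ { (c , α) → (t * c , α) }) p

    -- When αᵢ = 0 the coefficient of the derived term is 0.

    ∂ : Fin n → Poly n → Poly n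
    ∂ i = List.map (λ { (c , α) → (Vec.lookup α i · c , α [ i ]%= ℕ.pred) })

    D : ℝ^ n → Poly n → Poly n
    D u p = List.concat (List.tabulate (λ i → u i ∙ ∂ i p))

    D* : ∀ {k} → Vector (ℝ^ n) k → Poly n → Poly n
    D* vs p = Vector.foldr D p vs

    hessian : Poly n → ℝ^ n → Matrix n
    hessian g x i j = ⟦ ∂ i (∂ j g) ⟧ x

    -- The real number represented by a polynomial of degree 0.

    constant : Poly n → ℝ
    constant p = ⟦ p ⟧ 0⃗

    ConditionP : ∀ d → Vector (ℝ^ n) d → Poly n → Set
    ConditionP d vs g = 0# < constant (D* vs g)

    ConditionH : ∀ d → Vector (ℝ^ n) d → Poly n → Set
    ConditionH 0             vs g = ⊤
    ConditionH 1             vs g = ⊤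
    ConditionH (suc (suc k)) vs g =
      ExactlyOnePositiveEigenvalue
        (gram (λ x y → constant (D x (D y (D* (Vector.drop 2 vs) g)))))

    -- Both conditions are quantified over all of v₁, …, v_d, so (H) is vacuous for
    -- an empty cone even when d = 2, where no vᵢ occurs in it.

    IsLorentzian : Pred (ℝ^ n) 0ℓ → ℕ → Poly n → Set
    IsLorentzian C d g =
      Homogeneous d g
      × (IsZero g
         ⊎ (∀ (vs : Vector (ℝ^ n) d) → (∀ k → C (vs k)) →
            ConditionP d vs g × ConditionH d vs g))

{-# OPTIONS --safe #-}

-- Fix v₃, …, v_d in the cone and let A be the Hessian of D_{v₃} ⋯ D_{v_d} f.
-- By effectivity v₃ may be replaced by a positive vector p of the cone, so that
-- A = Σ p_k T_k, where T_k is the Hessian of D_{v₄} ⋯ D_{v_d} ∂_k f and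
-- T_k p is the k-th row of A. As ∂_k f is Lorentzian, each T_k satisfies the
-- reverse Cauchy–Schwarz inequality T_k(x) T_k(p) ≤ T_k(x, p)², and summation
-- gives the Bochner inequality A(x) ≤ Σ p_k (Ax)_k² / (Ap)_k.
-- Let ν_k = (Ap)_k / p_k. By the Bochner inequality an eigenvalue l > 0 of A
-- relative to diag ν is at least 1, and by irreducibility (the Perron–Frobenius
-- argument, in the form of a Dirichlet energy) every eigenvector with l ≥ 1 is a
-- multiple of p. Hence A is nonpositive on the hyperplane orthogonal to Ap. For
-- a symmetric A with A(p) > 0 this means exactly one positive eigenvalue.
-- Eigenvectors are produced from suprema of Rayleigh quotients, and definiteness
-- is decided by completing squares.

module Submission where

open import Defs
open import Level using (0ℓ)
open import Algebra.Bundles using (RawRing; Semiring)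
import Algebra.Definitions.RawSemiring as RawSemiringOps
import Algebra.Properties.CommutativeMonoid.Sum as CommutativeMonoidSum
import Algebra.Properties.Ring as RingProperties
import Algebra.Properties.Semiring.Mult.TCOptimised as SemiringMult
import Algebra.Properties.Semiring.Sum as SemiringSum
import Algebra.Solver.Ring as RingSolver
import Algebra.Solver.Ring.AlmostCommutativeRing as ACR
open import Data.Empty using (⊥-elim)
open import Data.Fin.Base using (Fin; zero; suc; inject₁; fromℕ)
open import Data.Fin.Properties using () renaming (_≟_ to _≟ᶠ_)
open import Data.Integer.Base as ℤ using (ℤ; +_; -[1+_])
import Data.Integer.Properties as ℤₚ
open import Data.List.Base as List using ([]; _∷_; _++_)
import Data.List.Properties as Listₚ
open import Data.Maybe.Base using (Maybe; just; nothing)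
open import Data.Nat.Base as ℕ using (ℕ; zero; suc; pred; s≤s; _∸_) renaming (_≤_ to _≤ⁿ_)
import Data.Nat.Properties as ℕₚ
open import Data.Product.Base using (_×_; _,_; ∃-syntax; proj₁; proj₂)
open import Data.Sum.Base using (_⊎_; inj₁; inj₂)
open import Data.Vec.Base as Vec using (lookup; _[_]%=_)
open import Data.Vec.Functional as Vector using (Vector)
import Data.Vec.Properties as Vecₚ
open import Function.Bundles using (Equivalence)
open import Relation.Binary.Definitions using (tri<; tri≈; tri>)
open import Relation.Binary.PropositionalEquality as ≡ using (_≡_; _≢_)
import Relation.Binary.Reasoning.Setoid as SetoidReasoning
open import Relation.Binary.Structures using (IsStrictTotalOrder)
open import Relation.Nullary using (Dec; yes; no; ¬_)
open import Relation.Nullary.Decidable using (¬?; decidable-stable)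
open import Relation.Unary using (Pred)

-- Completeness enters at one place only, the supremum l of a Rayleigh quotient M/N, and no
-- compactness is available to attain it. The form Q = l N - M is examined instead. Completing
-- squares yields either a uniform bound |x|² ≤ K Q(x) or a nonzero u with Q(u) ≤ 0. The bound would
-- allow l to be lowered; hence u exists, and since Q is semidefinite, u lies in its kernel and is
-- an eigenvector.
--
-- An eigenvector found this way need not lie in a prescribed hyperplane. Subtracting a suitable
-- rank-one form first makes the normal direction a kernel direction, and symmetry then puts every
-- eigenvector with positive eigenvalue into the hyperplane.
--
-- The vector p must be positive because its coordinates serve as weights when the inequalities for
-- the T_k are added, and as denominators in ν. A partial derivative may be the zero polynomial and
-- then gives no inequality; row k of A would vanish, which irreducibility and A(p) > 0 exclude.
--
-- Invariance of f concerns values while derivatives act on formal sums. First-order expansions with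
-- bounded remainder connect the two.

-- Ordered field arithmetic, with a ring solver over integer coefficients.

module OrderedField (𝕜 : CompleteOrderedField) where

  open CompleteOrderedField 𝕜 public
    hiding (Carrier; zero; _≤_; _<_; _≈_; _+_; _*_; -_; _-_; 0#; 1#)
  open Lorentzian 𝕜 public using (ℝ; _≈_; _+_; _*_; -_; _-_; 0#; 1#; _<_; _≤_)
  open SemiringSum semiring public
    using (sum; sum-cong-≋; *-distribˡ-sum; *-distribʳ-sum)
  open CommutativeMonoidSum +-commutativeMonoid public using (∑-distrib-+; ∑-comm)
  open RingProperties ring public using (-0#≈0#)
  open SetoidReasoning setoid public

  private
    open SemiringMult semiring using (×-homo-+; ×1-homo-*) renaming (_×_ to _·_)
    open RingProperties ring using (-‿distribˡ-*; -‿distribʳ-*; -‿involutive; -‿+-comm)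

    -- The optimised multiple makes `1 · 1#` reduce to `1#`, so that `con (+ 1)` in solver equations
    -- denotes `1#` itself.
    realℕ : ℕ → ℝ
    realℕ n = n · 1#

    realℤ : ℤ → ℝ
    realℤ (+ n)      = realℕ n
    realℤ (-[1+ n ]) = - realℕ (suc n)

    cancel : ∀ a b → (1# + a) + - (1# + b) ≈ a + - b
    cancel a b = begin
      (1# + a) + - (1# + b)     ≈⟨ +-cong (+-comm 1# a) (sym (-‿+-comm 1# b)) ⟩
      (a + 1#) + (- 1# + - b)   ≈⟨ +-assoc a 1# _ ⟩
      a + (1# + (- 1# + - b))   ≈⟨ +-congˡ (sym (+-assoc 1# _ _)) ⟩
      a + ((1# + - 1#) + - b)   ≈⟨ +-congˡ (+-congʳ (-‿inverseʳ 1#)) ⟩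
      a + (0# + - b)            ≈⟨ +-congˡ (+-identityˡ _) ⟩
      a + - b                   ∎

    realℤ-⊖ : ∀ m n → realℤ (m ℤ.⊖ n) ≈ realℕ m + - realℕ n
    realℤ-⊖ m zero = sym (trans (+-congˡ -0#≈0#) (+-identityʳ _))
    realℤ-⊖ zero (suc n) = sym (+-identityˡ _)
    realℤ-⊖ (suc m) (suc n) = begin
      realℤ (suc m ℤ.⊖ suc n) ≡⟨ ≡.cong realℤ (ℤₚ.[1+m]⊖[1+n]≡m⊖n m n) ⟩
      realℤ (m ℤ.⊖ n)         ≈⟨ realℤ-⊖ m n ⟩
      realℕ m + - realℕ n     ≈⟨ cancel _ _ ⟨
      (1# + realℕ m) + - (1# + realℕ n)
        ≈⟨ +-cong (×-homo-+ 1# 1 m) (-‿cong (×-homo-+ 1# 1 n)) ⟨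
      realℕ (suc m) + - realℕ (suc n) ∎

    realℤ-+ : ∀ x y → realℤ (x ℤ.+ y) ≈ realℤ x + realℤ y
    realℤ-+ (+ m)      (+ n)      = ×-homo-+ 1# m n
    realℤ-+ (+ m)      (-[1+ n ]) = realℤ-⊖ m (suc n)
    realℤ-+ (-[1+ m ]) (+ n)      = trans (realℤ-⊖ n (suc m)) (+-comm _ _)
    realℤ-+ (-[1+ m ]) (-[1+ n ]) = begin
      - realℕ (suc (suc (m ℕ.+ n)))    ≡⟨ ≡.cong (λ k → - realℕ (suc k)) (≡.sym (ℕ-+-suc m n)) ⟩
      - realℕ (suc m ℕ.+ suc n)        ≈⟨ -‿cong (×-homo-+ 1# (suc m) (suc n)) ⟩
      - (realℕ (suc m) + realℕ (suc n)) ≈⟨ -‿+-comm _ _ ⟨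
      - realℕ (suc m) + - realℕ (suc n) ∎
      where open import Data.Nat.Properties renaming (+-suc to ℕ-+-suc)

    realℤ-neg : ∀ x → realℤ (ℤ.- x) ≈ - realℤ x
    realℤ-neg (+ zero)   = sym -0#≈0#
    realℤ-neg (+ suc n)  = refl
    realℤ-neg (-[1+ n ]) = sym (-‿involutive _)

    realℤ-*⁺ : ∀ m n → realℤ (+ m ℤ.* + n) ≈ realℕ m * realℕ n
    realℤ-*⁺ m n = begin
      realℤ (+ m ℤ.* + n) ≡⟨ ≡.cong realℤ (≡.sym (ℤₚ.pos-* m n)) ⟩
      realℕ (m ℕ.* n)     ≈⟨ ×1-homo-* m n ⟩
      realℕ m * realℕ n   ∎

    realℤ-* : ∀ x y → realℤ (x ℤ.* y) ≈ realℤ x * realℤ y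
    realℤ-* (+ m)      (+ n)      = realℤ-*⁺ m n
    realℤ-* (+ m)      (-[1+ n ]) = begin
      realℤ (+ m ℤ.* (ℤ.- + suc n))   ≡⟨ ≡.cong realℤ (≡.sym (ℤₚ.neg-distribʳ-* (+ m) (+ suc n))) ⟩
      realℤ (ℤ.- (+ m ℤ.* + suc n))   ≈⟨ realℤ-neg (+ m ℤ.* + suc n) ⟩
      - realℤ (+ m ℤ.* + suc n)       ≈⟨ -‿cong (realℤ-*⁺ m (suc n)) ⟩
      - (realℕ m * realℕ (suc n))     ≈⟨ -‿distribʳ-* _ _ ⟩
      realℕ m * - realℕ (suc n)       ∎
    realℤ-* (-[1+ m ]) (+ n)      = begin
      realℤ ((ℤ.- + suc m) ℤ.* + n)   ≡⟨ ≡.cong realℤ (≡.sym (ℤₚ.neg-distribˡ-* (+ suc m) (+ n))) ⟩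
      realℤ (ℤ.- (+ suc m ℤ.* + n))   ≈⟨ realℤ-neg (+ suc m ℤ.* + n) ⟩
      - realℤ (+ suc m ℤ.* + n)       ≈⟨ -‿cong (realℤ-*⁺ (suc m) n) ⟩
      - (realℕ (suc m) * realℕ n)     ≈⟨ -‿distribˡ-* _ _ ⟩
      - realℕ (suc m) * realℕ n       ∎
    realℤ-* (-[1+ m ]) (-[1+ n ]) = begin
      realℤ (+ suc m ℤ.* + suc n)             ≈⟨ realℤ-*⁺ (suc m) (suc n) ⟩
      realℕ (suc m) * realℕ (suc n)           ≈⟨ -‿involutive _ ⟨
      - - (realℕ (suc m) * realℕ (suc n))     ≈⟨ -‿cong (-‿distribˡ-* _ _) ⟩
      - (- realℕ (suc m) * realℕ (suc n))     ≈⟨ -‿distribʳ-* _ _ ⟩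
      - realℕ (suc m) * - realℕ (suc n)       ∎

    ℤ-rawRing : RawRing 0ℓ 0ℓ
    ℤ-rawRing = record
      { Carrier = ℤ ; _≈_ = _≡_ ; _+_ = ℤ._+_ ; _*_ = ℤ._*_ ; -_ = ℤ.-_
      ; 0# = + 0 ; 1# = + 1 }

    realℤ-morphism : ℤ-rawRing ACR.-Raw-AlmostCommutative⟶ ACR.fromCommutativeRing commutativeRing
    realℤ-morphism = record
      { ⟦_⟧ = realℤ ; +-homo = realℤ-+ ; *-homo = realℤ-* ; -‿homo = realℤ-neg
      ; 0-homo = refl ; 1-homo = refl }

    _coeff≟_ : ∀ x y → Maybe (realℤ x ≈ realℤ y)
    x coeff≟ y with x ℤₚ.≟ y
    ... | yes ≡.refl = just refl
    ... | no _       = nothing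

  open RingSolver ℤ-rawRing (ACR.fromCommutativeRing commutativeRing)
    realℤ-morphism _coeff≟_ public
    using (solve; _:=_; _:+_; _:*_; _:-_; :-_; con)

  open IsStrictTotalOrder isStrictTotalOrder public
    using (compare; <-resp-≈)
    renaming (trans to <-trans; irrefl to <-irrefl; _≟_ to _≈?_)

  private
    variable
      a b c x y z : ℝ

  <-respˡ : x ≈ y → x < z → y < z
  <-respˡ = proj₂ <-resp-≈

  <-respʳ : x ≈ y → z < x → z < y
  <-respʳ = proj₁ <-resp-≈

  <-diff : x < y → 0# < y - x
  <-diff {x} {y} x<y = <-respˡ (-‿inverseʳ x) (+-monoˡ-< (- x) x<y)

  <-undiff : 0# < y - x → x < y
  <-undiff {y} {x} h = <-respˡ (+-identityˡ x)
    (<-respʳ (solve 2 (λ y x → (y :- x) :+ x := y) refl y x) (+-monoˡ-< x h))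

  ≤-diff : x ≤ y → 0# ≤ y - x
  ≤-diff (inj₁ x<y) = inj₁ (<-diff x<y)
  ≤-diff (inj₂ x≈y) = inj₂ (sym (trans (+-congˡ (-‿cong x≈y)) (-‿inverseʳ _)))

  ≤-undiff : 0# ≤ y - x → x ≤ y
  ≤-undiff (inj₁ h) = inj₁ (<-undiff h)
  ≤-undiff {y} {x} (inj₂ h) = inj₂ (begin
    x            ≈⟨ +-identityˡ x ⟨
    0# + x       ≈⟨ +-congʳ h ⟩
    (y - x) + x  ≈⟨ solve 2 (λ y x → (y :- x) :+ x := y) refl y x ⟩
    y            ∎)

  ≤-respˡ : x ≈ y → x ≤ z → y ≤ z
  ≤-respˡ x≈y (inj₁ h) = inj₁ (<-respˡ x≈y h)
  ≤-respˡ x≈y (inj₂ h) = inj₂ (trans (sym x≈y) h)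

  ≤-respʳ : x ≈ y → z ≤ x → z ≤ y
  ≤-respʳ x≈y (inj₁ h) = inj₁ (<-respʳ x≈y h)
  ≤-respʳ x≈y (inj₂ h) = inj₂ (trans h x≈y)

  -- The pattern of most estimates below: the difference of the two sides is written as an
  -- expression that is visibly nonnegative, and the solver checks the identity.
  ≤-via : 0# ≤ a → a ≈ y - x → x ≤ y
  ≤-via h e = ≤-undiff (≤-respʳ e h)

  <-via : 0# < a → a ≈ y - x → x < y
  <-via h e = <-undiff (<-respʳ e h)

  ≤-refl : x ≤ x
  ≤-refl = inj₂ refl

  <-≤-trans : x < y → y ≤ z → x < z
  <-≤-trans h (inj₁ k) = <-trans h k
  <-≤-trans h (inj₂ k) = <-respʳ k h

  ≤-trans : x ≤ y → y ≤ z → x ≤ z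
  ≤-trans (inj₁ h) k = inj₁ (<-≤-trans h k)
  ≤-trans (inj₂ h) k = ≤-respˡ (sym h) k

  <⇒≱ : x < y → ¬ (y ≤ x)
  <⇒≱ h k = <-irrefl refl (<-≤-trans h k)

  ≮⇒≥ : ¬ (x < y) → y ≤ x
  ≮⇒≥ {x} {y} h with compare x y
  ... | tri< p _ _ = ⊥-elim (h p)
  ... | tri≈ _ p _ = inj₂ (sym p)
  ... | tri> _ _ p = inj₁ p

  <-or-≥ : ∀ x y → x < y ⊎ y ≤ x
  <-or-≥ x y with compare x y
  ... | tri< p _ _ = inj₁ p
  ... | tri≈ _ p _ = inj₂ (inj₂ (sym p))
  ... | tri> _ _ p = inj₂ (inj₁ p)

  ≰⇒> : ¬ (x ≤ y) → y < x
  ≰⇒> {x} {y} h with <-or-≥ y x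
  ... | inj₁ p = p
  ... | inj₂ p = ⊥-elim (h p)

  ≤-antisym : x ≤ y → y ≤ x → x ≈ y
  ≤-antisym (inj₂ h) _ = h
  ≤-antisym (inj₁ h) k = ⊥-elim (<⇒≱ h k)

  +-pos-nonneg : 0# < x → 0# ≤ y → 0# < x + y
  +-pos-nonneg {x} {y} hx (inj₁ hy) =
    <-trans hy (<-respˡ (+-identityˡ y) (+-monoˡ-< y hx))
  +-pos-nonneg hx (inj₂ hy) = <-respʳ (trans (sym (+-identityʳ _)) (+-congˡ hy)) hx

  +-nonneg : 0# ≤ x → 0# ≤ y → 0# ≤ x + y
  +-nonneg (inj₁ hx) hy = inj₁ (+-pos-nonneg hx hy)
  +-nonneg (inj₂ hx) hy = ≤-respʳ (trans (sym (+-identityˡ _)) (+-congʳ hx)) hy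

  *-nonneg : 0# ≤ x → 0# ≤ y → 0# ≤ x * y
  *-nonneg (inj₁ hx) (inj₁ hy) = inj₁ (*-pos hx hy)
  *-nonneg (inj₂ hx) _ = inj₂ (trans (sym (zeroˡ _)) (*-congʳ hx))
  *-nonneg _ (inj₂ hy) = inj₂ (trans (sym (zeroʳ _)) (*-congˡ hy))

  neg-pos : x < 0# → 0# < - x
  neg-pos h = <-respʳ (+-identityˡ _) (<-diff h)

  halve-nonneg : 0# ≤ x + x → 0# ≤ x
  halve-nonneg {x} h = ≮⇒≥ λ x<0 → <⇒≱ (+-pos-nonneg (neg-pos x<0) (inj₁ (neg-pos x<0)))
    (≤-via h (solve 1 (λ x → x :+ x := con (+ 0) :- (:- x :+ :- x)) refl x))

  square-nonneg : ∀ x → 0# ≤ x * x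
  square-nonneg x with compare x 0#
  ... | tri< p _ _ = inj₁ (<-respʳ (solve 1 (λ x → :- x :* :- x := x :* x) refl x)
                                   (*-pos (neg-pos p) (neg-pos p)))
  ... | tri≈ _ p _ = inj₂ (sym (trans (*-congʳ p) (zeroˡ x)))
  ... | tri> _ _ p = inj₁ (*-pos p p)

  square-pos : ¬ (x ≈ 0#) → 0# < x * x
  square-pos {x} x≉0 with compare x 0#
  ... | tri< p _ _ = <-respʳ (solve 1 (λ x → :- x :* :- x := x :* x) refl x)
                             (*-pos (neg-pos p) (neg-pos p))
  ... | tri≈ _ p _ = ⊥-elim (x≉0 p)
  ... | tri> _ _ p = *-pos p p

  pos⇒≉0 : 0# < x → ¬ (x ≈ 0#)
  pos⇒≉0 h e = <-irrefl (sym e) h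

  0<1 : 0# < 1#
  0<1 = <-respʳ (*-identityˡ 1#) (square-pos (λ e → 0≉1 (sym e)))

  *-cancel-0 : ¬ (x ≈ 0#) → x * y ≈ 0# → y ≈ 0#
  *-cancel-0 {x} {y} x≉0 e with inverse x x≉0
  ... | x⁻¹ , h = begin
    y              ≈⟨ *-identityˡ y ⟨
    1# * y         ≈⟨ *-congʳ (sym h) ⟩
    (x * x⁻¹) * y  ≈⟨ solve 3 (λ x i y → (x :* i) :* y := i :* (x :* y)) refl x x⁻¹ y ⟩
    x⁻¹ * (x * y)  ≈⟨ *-congˡ e ⟩
    x⁻¹ * 0#       ≈⟨ zeroʳ _ ⟩
    0#             ∎

  *-cancelˡ-pos : 0# < x → 0# < x * y → 0# < y
  *-cancelˡ-pos {x} {y} hx h with compare 0# y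
  ... | tri< p _ _ = p
  ... | tri≈ _ p _ = ⊥-elim (<-irrefl (sym (trans (*-congˡ (sym p)) (zeroʳ x))) h)
  ... | tri> _ _ p = ⊥-elim (<-irrefl refl (<-respʳ
          (solve 2 (λ x y → x :* y :+ x :* (:- y) := con (+ 0)) refl x y)
          (+-pos-nonneg h (inj₁ (*-pos hx (neg-pos p))))))

  *-cancelˡ-nonneg : 0# < x → 0# ≤ x * y → 0# ≤ y
  *-cancelˡ-nonneg {x} {y} hx h with <-or-≥ y 0#
  ... | inj₂ p = p
  ... | inj₁ p = ⊥-elim (<-irrefl refl (<-respʳ
          (solve 2 (λ x y → x :* (:- y) :+ x :* y := con (+ 0)) refl x y)
          (+-pos-nonneg (*-pos hx (neg-pos p)) h)))

  abstract
    recip : 0# < x → ∃[ y ] 0# < y × x * y ≈ 1#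
    recip {x} hx with inverse x (pos⇒≉0 hx)
    ... | y , e = y , *-cancelˡ-pos hx (<-respʳ (sym e) 0<1) , e

  square-zero : x * x ≤ 0# → x ≈ 0#
  square-zero {x} h with x ≈? 0#
  ... | yes e = e
  ... | no x≉0 = ⊥-elim (<⇒≱ (square-pos x≉0) h)

  sum-nonneg : ∀ {n} {t : Vector ℝ n} → (∀ i → 0# ≤ t i) → 0# ≤ sum t
  sum-nonneg {zero}  h = ≤-refl
  sum-nonneg {suc n} h = +-nonneg (h zero) (sum-nonneg (λ i → h (suc i)))

  sum-term : ∀ {n} {t : Vector ℝ n} → (∀ i → 0# ≤ t i) → ∀ i → t i ≤ sum t
  sum-term {suc n} {t} h zero = ≤-via (sum-nonneg (λ i → h (suc i)))
    (solve 2 (λ x y → y := (x :+ y) :- x) refl _ _)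
  sum-term {suc n} {t} h (suc i) = ≤-trans (sum-term (λ i → h (suc i)) i)
    (≤-via (h zero) (solve 2 (λ x y → x := (x :+ y) :- y) refl _ _))

  sum-mono : ∀ {n} {s t : Vector ℝ n} → (∀ i → s i ≤ t i) → sum s ≤ sum t
  sum-mono {zero}  h = ≤-refl
  sum-mono {suc n} {s} {t} h = ≤-via
    (+-nonneg (≤-diff (h zero)) (≤-diff (sum-mono (λ i → h (suc i)))))
    (solve 4 (λ a b c d → (b :- a) :+ (d :- c) := (b :+ d) :- (a :+ c)) refl _ _ _ _)

  sum-0 : ∀ {n} {t : Vector ℝ n} → (∀ i → t i ≈ 0#) → sum t ≈ 0#
  sum-0 {zero}  h = refl
  sum-0 {suc n} h = trans (+-cong (h zero) (sum-0 (λ i → h (suc i)))) (+-identityˡ 0#)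

  nonneg-sum-0 : ∀ {n} {t : Vector ℝ n} → (∀ i → 0# ≤ t i) → sum t ≤ 0# → ∀ i → t i ≈ 0#
  nonneg-sum-0 h k i = ≤-antisym (≤-trans (sum-term h i) k) (h i)

-- Quadratic forms and the dichotomy between coercive and not definite.

module QuadraticForm (𝕜 : CompleteOrderedField) where

  open OrderedField 𝕜
  open Lorentzian 𝕜 using (ℝ^; Matrix; _≋_; 0⃗; _⊕_; _⊙_; _*ᵥ_)

  private
    variable
      n : ℕ

  dot : ℝ^ n → ℝ^ n → ℝ
  dot u v = sum (λ i → u i * v i)

  quad : Matrix n → ℝ^ n → ℝ
  quad M x = dot x (M *ᵥ x)

  Symmetric : Matrix n → Set
  Symmetric M = ∀ i j → M i j ≈ M j i

  dot-cong : ∀ {u u′ v v′ : ℝ^ n} → u ≋ u′ → v ≋ v′ → dot u v ≈ dot u′ v′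
  dot-cong p q = sum-cong-≋ (λ i → *-cong (p i) (q i))

  dot-comm : (u v : ℝ^ n) → dot u v ≈ dot v u
  dot-comm u v = sum-cong-≋ (λ i → *-comm (u i) (v i))

  dot-scaleʳ : ∀ a (u v : ℝ^ n) → dot u (a ⊙ v) ≈ a * dot u v
  dot-scaleʳ a u v = trans
    (sum-cong-≋ (λ i → solve 3 (λ a u v → u :* (a :* v) := a :* (u :* v)) refl a (u i) (v i)))
    (sym (*-distribˡ-sum a (λ i → u i * v i)))

  dot-combʳ : ∀ a b (u v w : ℝ^ n) →
              dot u ((a ⊙ v) ⊕ (b ⊙ w)) ≈ a * dot u v + b * dot u w
  dot-combʳ {n} a b u v w = begin
    dot u ((a ⊙ v) ⊕ (b ⊙ w))
      ≈⟨ sum-cong-≋ (λ i → distribˡ (u i) _ _) ⟩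
    sum (λ i → u i * (a * v i) + u i * (b * w i))
      ≈⟨ ∑-distrib-+ {n} _ _ ⟩
    dot u (a ⊙ v) + dot u (b ⊙ w)
      ≈⟨ +-cong (dot-scaleʳ a u v) (dot-scaleʳ b u w) ⟩
    a * dot u v + b * dot u w ∎

  dot-combˡ : ∀ a b (u v w : ℝ^ n) →
              dot ((a ⊙ v) ⊕ (b ⊙ w)) u ≈ a * dot v u + b * dot w u
  dot-combˡ a b u v w = trans (dot-comm _ u) (trans (dot-combʳ a b u v w)
    (+-cong (*-congˡ (dot-comm u v)) (*-congˡ (dot-comm u w))))

  *ᵥ-comb : ∀ (M : Matrix n) a b u v →
            M *ᵥ ((a ⊙ u) ⊕ (b ⊙ v)) ≋ (a ⊙ (M *ᵥ u)) ⊕ (b ⊙ (M *ᵥ v))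
  *ᵥ-comb M a b u v i = dot-combʳ a b (M i) u v

  *ᵥ-cong : ∀ (M : Matrix n) {u v} → u ≋ v → M *ᵥ u ≋ M *ᵥ v
  *ᵥ-cong M p i = dot-cong {u = M i} (λ _ → refl) p

  self-adjoint : ∀ {M : Matrix n} → Symmetric M → ∀ x y → dot x (M *ᵥ y) ≈ dot y (M *ᵥ x)
  self-adjoint {n} {M} M-sym x y = begin
    sum (λ i → x i * sum (λ j → M i j * y j))
      ≈⟨ sum-cong-≋ (λ i → *-distribˡ-sum {n} (x i) _) ⟩
    sum (λ i → sum (λ j → x i * (M i j * y j)))
      ≈⟨ ∑-comm {n} {n} _ ⟩
    sum (λ j → sum (λ i → x i * (M i j * y j)))
      ≈⟨ sum-cong-≋ (λ j → sum-cong-≋ (λ i → trans (*-congˡ (*-congʳ (M-sym i j)))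
           (solve 3 (λ x m y → x :* (m :* y) := y :* (m :* x)) refl (x i) (M j i) (y j)))) ⟩
    sum (λ j → sum (λ i → y j * (M j i * x i)))
      ≈⟨ sum-cong-≋ (λ j → sym (*-distribˡ-sum {n} (y j) _)) ⟩
    sum (λ j → y j * sum (λ i → M j i * x i)) ∎

  quad-cong : ∀ (M : Matrix n) {u v} → u ≋ v → quad M u ≈ quad M v
  quad-cong M p = dot-cong p (*ᵥ-cong M p)

  quad-comb : ∀ {M : Matrix n} → Symmetric M → ∀ a b x y →
              quad M ((a ⊙ x) ⊕ (b ⊙ y)) ≈
              a * a * quad M x + (a * b + a * b) * dot x (M *ᵥ y) + b * b * quad M y
  quad-comb {M = M} M-sym a b x y = begin
    quad M z                                                ≈⟨ dot-combˡ a b (M *ᵥ z) x y ⟩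
    a * dot x (M *ᵥ z) + b * dot y (M *ᵥ z)                 ≈⟨ +-cong (*-congˡ (expand x)) (*-congˡ (expand y)) ⟩
    a * (a * quad M x + b * xy) + b * (a * dot y (M *ᵥ x) + b * quad M y)
      ≈⟨ +-congˡ (*-congˡ (+-congʳ (*-congˡ (self-adjoint M-sym y x)))) ⟩
    a * (a * quad M x + b * xy) + b * (a * xy + b * quad M y)
      ≈⟨ solve 5 (λ a b p q r → a :* (a :* p :+ b :* q) :+ b :* (a :* q :+ b :* r)
           := a :* a :* p :+ (a :* b :+ a :* b) :* q :+ b :* b :* r) refl a b _ xy _ ⟩
    a * a * quad M x + (a * b + a * b) * xy + b * b * quad M y ∎
    where
    z = (a ⊙ x) ⊕ (b ⊙ y)
    xy = dot x (M *ᵥ y)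
    expand : ∀ w → dot w (M *ᵥ z) ≈ a * dot w (M *ᵥ x) + b * dot w (M *ᵥ y)
    expand w = trans (dot-cong {u = w} (λ _ → refl) (*ᵥ-comb M a b x y)) (dot-combʳ a b w _ _)

  norm²-nonneg : (x : ℝ^ n) → 0# ≤ dot x x
  norm²-nonneg x = sum-nonneg (λ i → square-nonneg (x i))

  norm²-zero : (x : ℝ^ n) → dot x x ≤ 0# → x ≋ 0⃗
  norm²-zero x h i = square-zero (inj₂ (nonneg-sum-0 (λ i → square-nonneg (x i)) h i))

  norm²-pos : (x : ℝ^ n) → ¬ (x ≋ 0⃗) → 0# < dot x x
  norm²-pos x x≉0 with <-or-≥ 0# (dot x x)
  ... | inj₁ h = h
  ... | inj₂ h = ⊥-elim (x≉0 (norm²-zero x h))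

  abstract
    -- A crude Cauchy-Schwarz inequality, enough because only the existence of a constant matters.
    -- In the inductive step (y + t)² ≤ 2y² + 2t², with y the first summand and t the remaining
    -- ones, which doubles both constants.
    dot-bounded : (b : ℝ^ n) → ∃[ B ] 0# ≤ B × (∀ x → dot b x * dot b x ≤ B * dot x x)
    dot-bounded {zero} b = 0# , ≤-refl , λ x → inj₂ (trans (zeroˡ 0#) (sym (zeroˡ 0#)))
    dot-bounded {suc n} b with dot-bounded (λ i → b (suc i))
    ... | B , B≥0 , bound = (s + s) + (B + B) , +-nonneg (+-nonneg s≥0 s≥0) (+-nonneg B≥0 B≥0) , λ x →
      let xr = λ i → x (suc i)
          t = dot (λ i → b (suc i)) xr
          X = dot xr xr
          X≥0 = norm²-nonneg xr
          sX = *-nonneg s≥0 X≥0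
          Bx = *-nonneg B≥0 (square-nonneg (x zero))
          tB = ≤-diff (bound xr)
      in ≤-via
           (+-nonneg (+-nonneg (square-nonneg (b zero * x zero - t)) (+-nonneg sX sX))
                     (+-nonneg (+-nonneg Bx Bx) (+-nonneg tB tB)))
           (solve 5 (λ b x t X B →
             ((b :* x :- t) :* (b :* x :- t) :+ (b :* b :* X :+ b :* b :* X))
               :+ ((B :* (x :* x) :+ B :* (x :* x)) :+ ((B :* X :- t :* t) :+ (B :* X :- t :* t)))
             := ((b :* b :+ b :* b) :+ (B :+ B)) :* (x :* x :+ X)
                :- (b :* x :+ t) :* (b :* x :+ t))
             refl (b zero) (x zero) t X B)
      where
      s : ℝ
      s = b zero * b zero
      s≥0 : 0# ≤ s
      s≥0 = square-nonneg (b zero)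

  abstract
    -- Each x_i (Mx)_i is at most x_i² + (Mx)_i². The x_i² add up to the summand 1 of the constant,
    -- and the rows, bounded separately, contribute `B`.
    quad-bounded : (M : Matrix n) → ∃[ b ] 0# ≤ b × (∀ x → quad M x ≤ b * dot x x)
    quad-bounded M = 1# + B , +-nonneg (inj₁ 0<1) B≥0 , bound
      where
      B : ℝ
      B = sum (λ i → proj₁ (dot-bounded (M i)))
      B≥0 : 0# ≤ B
      B≥0 = sum-nonneg (λ i → proj₁ (proj₂ (dot-bounded (M i))))
      bound : ∀ x → quad M x ≤ (1# + B) * dot x x
      bound x = ≤-trans (sum-mono term) (inj₂ (begin
        sum (λ i → x i * x i + proj₁ (dot-bounded (M i)) * dot x x)
          ≈⟨ ∑-distrib-+ (λ i → x i * x i) _ ⟩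
        dot x x + sum (λ i → proj₁ (dot-bounded (M i)) * dot x x)
          ≈⟨ +-cong (sym (*-identityˡ _)) (sym (*-distribʳ-sum (dot x x) (λ i → proj₁ (dot-bounded (M i))))) ⟩
        1# * dot x x + B * dot x x
          ≈⟨ distribʳ _ _ _ ⟨
        (1# + B) * dot x x ∎))
        where
        -- x y ≤ x² + y², because 2(x² + y² − x y) = (x − y)² + x² + y².
        term : ∀ i → x i * (M *ᵥ x) i ≤ x i * x i + proj₁ (dot-bounded (M i)) * dot x x
        term i = ≤-undiff (halve-nonneg (≤-respʳ
          (solve 3 (λ x y N →
              ((x :- y) :* (x :- y) :+ (x :* x :+ y :* y)) :+ ((N :- y :* y) :+ (N :- y :* y))
              := ((x :* x :+ N) :- x :* y) :+ ((x :* x :+ N) :- x :* y)) refl (x i) ((M *ᵥ x) i) N)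
          (+-nonneg (+-nonneg (square-nonneg (x i - (M *ᵥ x) i))
                              (+-nonneg (square-nonneg (x i)) (square-nonneg ((M *ᵥ x) i))))
                    (+-nonneg gap gap))))
          where
          N : ℝ
          N = proj₁ (dot-bounded (M i)) * dot x x
          gap : 0# ≤ N - (M *ᵥ x) i * (M *ᵥ x) i
          gap = ≤-diff (proj₂ (proj₂ (dot-bounded (M i))) x)

  -- Positive definiteness with a uniform constant, which is what compactness of the sphere would
  -- extract from pointwise positivity.
  Coercive : Matrix n → Set
  Coercive Q = ∃[ K ] 0# < K × (∀ x → dot x x ≤ K * quad Q x)

  private
    minor : Matrix (suc n) → Matrix n
    minor Q i j = Q (suc i) (suc j)

    quad-split : ∀ {Q : Matrix (suc n)} → Symmetric Q → ∀ x →
                 let β = dot (Vector.tail (Q zero)) (Vector.tail x) in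
                 quad Q x ≈ Q zero zero * (x zero * x zero) + (x zero * β + x zero * β)
                            + quad (minor Q) (Vector.tail x)
    quad-split {n} {Q} Q-sym x = begin
      x₀ * (a * x₀ + β) + sum (λ i → xr i * (Q (suc i) zero * x₀ + r i))
        ≈⟨ +-congˡ (sum-cong-≋ (λ i → trans (distribˡ (xr i) _ _)
             (+-congʳ (trans (*-congˡ (*-congʳ (Q-sym (suc i) zero)))
               (solve 3 (λ x q y → x :* (q :* y) := y :* (q :* x)) refl (xr i) (Q zero (suc i)) x₀))))) ⟩
      x₀ * (a * x₀ + β) + sum (λ i → x₀ * (Q zero (suc i) * xr i) + xr i * r i)
        ≈⟨ +-congˡ (∑-distrib-+ {n} _ _) ⟩
      x₀ * (a * x₀ + β) + (sum (λ i → x₀ * (Q zero (suc i) * xr i)) + quad (minor Q) xr)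
        ≈⟨ +-congˡ (+-congʳ (*-distribˡ-sum {n} x₀ _)) ⟨
      x₀ * (a * x₀ + β) + (x₀ * β + quad (minor Q) xr)
        ≈⟨ solve 4 (λ x a b q → x :* (a :* x :+ b) :+ (x :* b :+ q)
             := a :* (x :* x) :+ (x :* b :+ x :* b) :+ q) refl x₀ a β _ ⟩
      a * (x₀ * x₀) + (x₀ * β + x₀ * β) + quad (minor Q) xr ∎
      where
      a = Q zero zero
      x₀ = x zero
      xr = Vector.tail x
      r = minor Q *ᵥ xr
      β = dot (Vector.tail (Q zero)) xr

  rank-one : ℝ → ℝ^ n → Matrix n
  rank-one c b i j = c * (b i * b j)

  _⊝_ : Matrix n → Matrix n → Matrix n
  (M ⊝ N) i j = M i j - N i j

  ⊝-*ᵥ : (M N : Matrix n) → ∀ x i → ((M ⊝ N) *ᵥ x) i ≈ (M *ᵥ x) i - (N *ᵥ x) i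
  ⊝-*ᵥ {n} M N x i = begin
    sum (λ j → (M i j - N i j) * x j)
      ≈⟨ sum-cong-≋ (λ j → solve 3 (λ m n x → (m :- n) :* x := m :* x :+ (:- con (+ 1)) :* (n :* x)) refl (M i j) (N i j) (x j)) ⟩
    sum (λ j → M i j * x j + (- 1#) * (N i j * x j))
      ≈⟨ ∑-distrib-+ {n} _ _ ⟩
    (M *ᵥ x) i + sum (λ j → (- 1#) * (N i j * x j))
      ≈⟨ +-congˡ (*-distribˡ-sum {n} _ _) ⟨
    (M *ᵥ x) i + (- 1#) * (N *ᵥ x) i
      ≈⟨ solve 2 (λ m n → m :+ (:- con (+ 1)) :* n := m :- n) refl _ _ ⟩
    (M *ᵥ x) i - (N *ᵥ x) i ∎

  rank-one-*ᵥ : ∀ c (b : ℝ^ n) x i → (rank-one c b *ᵥ x) i ≈ c * dot b x * b i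
  rank-one-*ᵥ {n} c b x i = begin
    sum (λ j → c * (b i * b j) * x j)
      ≈⟨ sum-cong-≋ (λ j → solve 4 (λ c p q x → c :* (p :* q) :* x := (c :* p) :* (q :* x)) refl c (b i) (b j) (x j)) ⟩
    sum (λ j → (c * b i) * (b j * x j))
      ≈⟨ *-distribˡ-sum {n} (c * b i) _ ⟨
    c * b i * dot b x
      ≈⟨ solve 3 (λ c p q → c :* p :* q := c :* q :* p) refl c (b i) _ ⟩
    c * dot b x * b i ∎

  rank-one-sym : ∀ c (b : ℝ^ n) → Symmetric (rank-one c b)
  rank-one-sym c b i j = *-congˡ (*-comm (b i) (b j))

  ⊝-sym : {M N : Matrix n} → Symmetric M → Symmetric N → Symmetric (M ⊝ N)
  ⊝-sym p q i j = +-cong (p i j) (-‿cong (q i j))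

  quad-⊝ : (M N : Matrix n) → ∀ x → quad (M ⊝ N) x ≈ quad M x - quad N x
  quad-⊝ {n} M N x = begin
    dot x ((M ⊝ N) *ᵥ x)
      ≈⟨ dot-cong {u = x} (λ _ → refl) (λ i → trans (⊝-*ᵥ M N x i)
           (solve 2 (λ m n → m :- n := con (+ 1) :* m :+ (:- con (+ 1)) :* n) refl _ _)) ⟩
    dot x ((1# ⊙ (M *ᵥ x)) ⊕ ((- 1#) ⊙ (N *ᵥ x)))
      ≈⟨ dot-combʳ _ _ x _ _ ⟩
    1# * quad M x + (- 1#) * quad N x
      ≈⟨ solve 2 (λ m n → con (+ 1) :* m :+ (:- con (+ 1)) :* n := m :- n) refl _ _ ⟩
    quad M x - quad N x ∎

  quad-rank-one : ∀ c (b x : ℝ^ n) → quad (rank-one c b) x ≈ c * (dot b x * dot b x)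
  quad-rank-one {n} c b x = begin
    dot x (rank-one c b *ᵥ x)   ≈⟨ dot-cong {u = x} (λ _ → refl) (rank-one-*ᵥ c b x) ⟩
    dot x ((c * dot b x) ⊙ b)   ≈⟨ dot-scaleʳ _ x b ⟩
    (c * dot b x) * dot x b     ≈⟨ *-congˡ (dot-comm x b) ⟩
    (c * dot b x) * dot b x     ≈⟨ *-assoc _ _ _ ⟩
    c * (dot b x * dot b x)     ∎

  -- By induction on the dimension, completing the square in the first variable.
  abstract
    coercive-or-not-definite : (Q : Matrix n) → Symmetric Q →
      Coercive Q ⊎ ∃[ u ] ¬ (u ≋ 0⃗) × quad Q u ≤ 0#
    coercive-or-not-definite {zero} Q Q-sym =
      inj₁ (1# , 0<1 , λ x → inj₂ (sym (zeroʳ 1#)))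
    coercive-or-not-definite {suc n} Q Q-sym with <-or-≥ 0# (Q zero zero)
    ... | inj₂ a≤0 = inj₂ (e , (λ e≋0 → 0≉1 (sym (e≋0 zero))) , ≤-respˡ (sym quad-e) a≤0)
      where
      e : ℝ^ (suc n)
      e = 1# Vector.∷ 0⃗
      quad-e : quad Q e ≈ Q zero zero
      quad-e = begin
        quad Q e
          ≈⟨ quad-split Q-sym e ⟩
        Q zero zero * (1# * 1#) + (1# * dot (Vector.tail (Q zero)) 0⃗ + 1# * dot (Vector.tail (Q zero)) 0⃗)
          + quad (minor Q) 0⃗
          ≈⟨ +-cong (+-cong (*-congˡ (*-identityˡ 1#)) (+-cong (*-congˡ β0) (*-congˡ β0)))
               (sum-0 (λ i → zeroˡ ((minor Q *ᵥ 0⃗) i))) ⟩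
        Q zero zero * 1# + (1# * 0# + 1# * 0#) + 0#
          ≈⟨ solve 2 (λ a o → a :* o :+ (o :* con (+ 0) :+ o :* con (+ 0)) :+ con (+ 0) := a :* o) refl (Q zero zero) 1# ⟩
        Q zero zero * 1#
          ≈⟨ *-identityʳ _ ⟩
        Q zero zero ∎
        where
        β0 : dot (Vector.tail (Q zero)) 0⃗ ≈ 0#
        β0 = sum-0 (λ i → zeroʳ (Q zero (suc i)))
    ... | inj₁ a>0 with recip a>0
    ... | c , c>0 , ac≈1 = step (coercive-or-not-definite S S-sym)
      where
      a : ℝ
      a = Q zero zero
      b : ℝ^ n
      b = Vector.tail (Q zero)
      -- The Schur complement of the pivot a, where c = 1/a: the form that remains once the square
      -- in the first variable is completed.
      S : Matrix n
      S = minor Q ⊝ rank-one c b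
      S-sym : Symmetric S
      S-sym = ⊝-sym (λ i j → Q-sym (suc i) (suc j)) (rank-one-sym c b)
      quad-S : ∀ x → quad S x ≈ quad (minor Q) x - c * (dot b x * dot b x)
      quad-S x = trans (quad-⊝ (minor Q) (rank-one c b) x) (+-congˡ (-‿cong (quad-rank-one c b x)))
      complete : ∀ x → let y = x zero + c * dot b (Vector.tail x) in
                 quad Q x ≈ a * (y * y) + quad S (Vector.tail x)
      complete x = begin
        quad Q x
          ≈⟨ quad-split Q-sym x ⟩
        a * (x₀ * x₀) + (x₀ * β + x₀ * β) + q
          ≈⟨ +-congʳ (+-congˡ (+-cong ac ac)) ⟨
        a * (x₀ * x₀) + (a * c * (x₀ * β) + a * c * (x₀ * β)) + q
          ≈⟨ solve 5 (λ a c x β q → a :* (x :* x) :+ (a :* c :* (x :* β) :+ a :* c :* (x :* β)) :+ q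
                := a :* ((x :+ c :* β) :* (x :+ c :* β)) :+ (q :- (a :* c) :* (c :* (β :* β)))) refl a c x₀ β q ⟩
        a * (y * y) + (q - a * c * (c * (β * β)))
          ≈⟨ +-congˡ (+-congˡ (-‿cong (trans (*-congʳ ac≈1) (*-identityˡ _)))) ⟩
        a * (y * y) + (q - c * (β * β))
          ≈⟨ +-congˡ (quad-S (Vector.tail x)) ⟨
        a * (y * y) + quad S (Vector.tail x) ∎
        where
        x₀ β q y : ℝ
        x₀ = x zero
        β = dot b (Vector.tail x)
        q = quad (minor Q) (Vector.tail x)
        y = x₀ + c * β
        ac : ∀ {t} → a * c * t ≈ t
        ac = trans (*-congʳ ac≈1) (*-identityˡ _)
      step : Coercive S ⊎ (∃[ u ] ¬ (u ≋ 0⃗) × quad S u ≤ 0#) →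
             Coercive Q ⊎ (∃[ u ] ¬ (u ≋ 0⃗) × quad Q u ≤ 0#)
      step (inj₂ (u , u≉0 , h)) = inj₂ (v , (λ v≋0 → u≉0 (λ i → v≋0 (suc i))) ,
          ≤-respˡ (sym (trans (complete v) eq)) h)
        where
        v : ℝ^ (suc n)
        -- The first coordinate is chosen to make the completed square vanish, so that Q(v) = S(u).
        v = (- (c * dot b u)) Vector.∷ u
        eq : a * ((- (c * dot b u) + c * dot b u) * (- (c * dot b u) + c * dot b u)) + quad S u ≈ quad S u
        eq = solve 3 (λ a t q → a :* ((:- t :+ t) :* (:- t :+ t)) :+ q := q) refl a (c * dot b u) (quad S u)
      step (inj₁ (K , K>0 , bound)) with dot-bounded b
      ... | B , B≥0 , b-bound = inj₁ (K′ , K′>0 , bound′)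
        where
        L : ℝ
        L = c * c * B
        L≥0 : 0# ≤ L
        L≥0 = *-nonneg (square-nonneg c) B≥0
        -- From x₀ = y - cβ follow x₀² ≤ 2y² + 2c²β² and c²β² ≤ L X, while X ≤ K s. With 1 = a c
        -- this gives x₀² + X ≤ 2c (a y²) + (K + 2LK) s, and `K′` is the sum of the two
        -- coefficients. The slacks of these three estimates are z², `g₁` and `g₂`; `g₃` is the
        -- surplus from using one constant for both terms.
        K′ : ℝ
        K′ = K + ((c + c) + (L + L) * K)
        LK≥0 : 0# ≤ (L + L) * K
        LK≥0 = *-nonneg (+-nonneg L≥0 L≥0) (inj₁ K>0)
        K′>0 : 0# < K′
        K′>0 = +-pos-nonneg K>0 (+-nonneg (+-nonneg (inj₁ c>0) (inj₁ c>0)) LK≥0)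
        bound′ : ∀ x → dot x x ≤ K′ * quad Q x
        bound′ x = ≤-respʳ (*-congˡ (sym (complete x))) (≤-via nonneg (sym (begin
            K′ * (a * (y * y) + s) - (x₀ * x₀ + X)
              ≈⟨ solve 8 (λ x₀ c β B X K s a →
                   let y = x₀ :+ c :* β ; L = c :* c :* B ; z = y :+ c :* β
                       w = (a :* c) :* (y :* y) :- y :* y
                       g₁ = c :* c :* (B :* X :- β :* β)
                       g₂ = K :* s :- X
                       g₃ = (K :+ (L :+ L) :* K) :* (a :* (y :* y)) :+ (c :+ c) :* s
                   in (K :+ ((c :+ c) :+ (L :+ L) :* K)) :* (a :* (y :* y) :+ s) :- (x₀ :* x₀ :+ X)
                   := ((z :* z :+ (g₁ :+ g₁)) :+ (g₂ :+ (L :+ L) :* g₂) :+ g₃) :+ (w :+ w))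
                   refl x₀ c β B X K s a ⟩
            total + (w + w)
              ≈⟨ +-congˡ (trans (+-cong w≈0 w≈0) (+-identityˡ 0#)) ⟩
            total + 0#
              ≈⟨ +-identityʳ _ ⟩
            total ∎)))
          where
          xr : ℝ^ n
          xr = Vector.tail x
          x₀ β X s y z g₁ g₂ g₃ total w : ℝ
          x₀ = x zero
          β = dot b xr
          X = dot xr xr
          s = quad S xr
          y = x₀ + c * β
          z = y + c * β
          g₁ = c * c * (B * X - β * β)
          g₂ = K * s - X
          g₃ = (K + (L + L) * K) * (a * (y * y)) + (c + c) * s
          total = (z * z + (g₁ + g₁)) + (g₂ + (L + L) * g₂) + g₃
          -- The solver does not know a c = 1; `w` isolates the multiple of a c - 1 that is removed
          -- by hand.
          w = (a * c) * (y * y) - y * y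
          w≈0 : w ≈ 0#
          w≈0 = trans (+-congʳ (trans (*-congʳ ac≈1) (*-identityˡ _))) (-‿inverseʳ _)
          s≥0 : 0# ≤ s
          s≥0 = *-cancelˡ-nonneg K>0 (≤-trans (norm²-nonneg xr) (bound xr))
          g₁≥0 : 0# ≤ g₁
          g₁≥0 = *-nonneg (square-nonneg c) (≤-diff (b-bound xr))
          g₂≥0 : 0# ≤ g₂
          g₂≥0 = ≤-diff (bound xr)
          nonneg : 0# ≤ total
          nonneg = +-nonneg (+-nonneg (+-nonneg (square-nonneg z) (+-nonneg g₁≥0 g₁≥0))
            (+-nonneg g₂≥0 (*-nonneg (+-nonneg L≥0 L≥0) g₂≥0)))
            (+-nonneg (*-nonneg (+-nonneg (inj₁ K>0) LK≥0) (*-nonneg (inj₁ a>0) (square-nonneg y)))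
                      (*-nonneg (+-nonneg (inj₁ c>0) (inj₁ c>0)) s≥0))

-- Generalised eigenvectors from suprema of Rayleigh quotients.

module Eigenvalue (𝕜 : CompleteOrderedField) where

  open OrderedField 𝕜
  open QuadraticForm 𝕜
  open Lorentzian 𝕜 using (ℝ^; Matrix; _≋_; 0⃗; _⊕_; _⊙_; _*ᵥ_)

  private
    variable
      n : ℕ

  _⊛_ : ℝ → Matrix n → Matrix n
  (t ⊛ M) i j = t * M i j

  ⊛-*ᵥ : ∀ t (M : Matrix n) x i → ((t ⊛ M) *ᵥ x) i ≈ t * (M *ᵥ x) i
  ⊛-*ᵥ {n} t M x i = trans (sum-cong-≋ (λ j → *-assoc t (M i j) (x j)))
    (sym (*-distribˡ-sum {n} t _))

  quad-⊛ : ∀ t (M : Matrix n) x → quad (t ⊛ M) x ≈ t * quad M x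
  quad-⊛ t M x = trans (dot-cong {u = x} (λ _ → refl) (⊛-*ᵥ t M x)) (dot-scaleʳ t x (M *ᵥ x))

  -- Evaluate Q at (1 + b) u − Q u, where b bounds the form Q: as
  -- Q(u) ≤ 0, this is at most −(2 + b) |Q u|².
  semidefinite-kernel : ∀ {Q : Matrix n} → Symmetric Q → (∀ x → 0# ≤ quad Q x) →
    ∀ {u} → quad Q u ≤ 0# → Q *ᵥ u ≋ 0⃗
  semidefinite-kernel {n} {Q} Q-sym psd {u} h = norm²-zero v (≮⇒≥ λ w>0 →
      <⇒≱ (+-pos-nonneg (+-pos-nonneg w>0 (inj₁ w>0)) (*-nonneg b≥0 (inj₁ w>0))) total)
    where
    b : ℝ
    b = proj₁ (quad-bounded Q)
    b≥0 : 0# ≤ b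
    b≥0 = proj₁ (proj₂ (quad-bounded Q))
    bound : ∀ x → quad Q x ≤ b * dot x x
    bound = proj₂ (proj₂ (quad-bounded Q))
    v : ℝ^ n
    v = Q *ᵥ u
    w : ℝ
    w = dot v v
    k : ℝ
    k = 1# + b
    x : ℝ^ n
    x = (k ⊙ u) ⊕ ((- 1#) ⊙ v)
    qx : quad Q x ≈ k * k * quad Q u + (k * - 1# + k * - 1#) * w + - 1# * - 1# * quad Q v
    qx = trans (quad-comb Q-sym k (- 1#) u v) (+-congʳ (+-congˡ (*-congˡ (self-adjoint Q-sym u v))))
    nonneg : 0# ≤ (quad Q x + k * k * (0# - quad Q u)) + (b * w - quad Q v)
    nonneg = +-nonneg (+-nonneg (psd x) (*-nonneg (square-nonneg k) (≤-diff h))) (≤-diff (bound v))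
    total : (w + w) + b * w ≤ 0#
    total = ≤-via nonneg (trans (+-congʳ (+-congʳ qx)) (solve 4 (λ b qu w qv → let k = con (+ 1) :+ b in
               ((k :* k :* qu :+ (k :* (:- con (+ 1)) :+ k :* (:- con (+ 1))) :* w
                   :+ (:- con (+ 1)) :* (:- con (+ 1)) :* qv)
                 :+ k :* k :* (con (+ 0) :- qu)) :+ (b :* w :- qv)
               := con (+ 0) :- ((w :+ w) :+ b :* w)) refl b (quad Q u) w (quad Q v)))

  coercive-pos : ∀ {N : Matrix n} → Coercive N → ∀ {x} → ¬ (x ≋ 0⃗) → 0# < quad N x
  coercive-pos (K , K>0 , coercive) {x} x≉0 = *-cancelˡ-pos K>0 (<-≤-trans (norm²-pos x x≉0) (coercive x))

  coercive-nonneg : ∀ {N : Matrix n} → Coercive N → ∀ x → 0# ≤ quad N x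
  coercive-nonneg (K , K>0 , coercive) x = *-cancelˡ-nonneg K>0 (≤-trans (norm²-nonneg x) (coercive x))

  quad-pos⇒nonzero : ∀ {M : Matrix n} {x} → 0# < quad M x → ¬ (x ≋ 0⃗)
  quad-pos⇒nonzero {M = M} {x} h x≋0 =
    <-irrefl (sym (trans (quad-cong M x≋0) (sum-0 (λ i → zeroˡ ((M *ᵥ 0⃗) i))))) h

  abstract
    relatively-bounded : (M : Matrix n) {N : Matrix n} → Coercive N →
      ∃[ b ] 0# ≤ b × (∀ x → quad M x ≤ b * quad N x)
    relatively-bounded M {N} (K , K>0 , coercive) with quad-bounded M
    ... | b , b≥0 , bound = b * K , *-nonneg b≥0 (inj₁ K>0) , λ x →
      ≤-trans (bound x) (≤-via (*-nonneg b≥0 (≤-diff (coercive x))) (eq b K (quad N x) (dot x x)))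
      where
      eq : ∀ b K q X → b * (K * q - X) ≈ b * K * q - b * X
      eq = solve 4 (λ b K q X → b :* (K :* q :- X) := b :* K :* q :- b :* X) refl

  private
    quotient : ∀ {q} m → 0# < q → 0# < m → ∃[ t ] 0# < t × t * q ≈ m
    quotient {q} m q>0 m>0 with recip q>0
    ... | r , r>0 , e = m * r , *-pos m>0 r>0 , (begin
      m * r * q    ≈⟨ solve 3 (λ m r q → m :* r :* q := m :* (q :* r)) refl m r q ⟩
      m * (q * r)  ≈⟨ *-congˡ e ⟩
      m * 1#       ≈⟨ *-identityʳ m ⟩
      m            ∎)

    *-cancelʳ-≤ : ∀ {q s t} → 0# < q → s * q ≤ t * q → s ≤ t
    *-cancelʳ-≤ {q} {s} {t} q>0 h = ≤-undiff (*-cancelˡ-nonneg q>0 (≤-respʳ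
      (solve 3 (λ q s t → t :* q :- s :* q := q :* (t :- s)) refl q s t) (≤-diff h)))

    *-monoʳ-≤ : ∀ {q s t} → 0# ≤ q → s ≤ t → s * q ≤ t * q
    *-monoʳ-≤ {q} {s} {t} q≥0 h = ≤-via (*-nonneg q≥0 (≤-diff h))
      (solve 3 (λ q s t → q :* (t :- s) := t :* q :- s :* q) refl q s t)

  private
    when-pos : ∀ {a b} → 0# ≤ b → (0# < a → a ≤ b) → a ≤ b
    when-pos {a} {b} b≥0 f with <-or-≥ 0# a
    ... | inj₁ h = f h
    ... | inj₂ h = ≤-trans h b≥0

  abstract
    -- The supremum of M(x)/N(x), described as the least factor e with M ≤ e N. It is positive
    -- because the quotient at y is. That it is attained is neither claimed nor needed at this
    -- stage.
    maximal-rayleigh-quotient : ∀ {M N : Matrix n} → Coercive N → ∀ y → 0# < quad M y →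
      ∃[ ev ] 0# < ev × (∀ x → quad M x ≤ ev * quad N x)
              × (∀ e → (∀ x → quad M x ≤ e * quad N x) → ev ≤ e)
    maximal-rayleigh-quotient {n} {M} {N} N-coercive y My>0 =
      finish (supremum S (t₀ , t₀∈S) (proj₁ bounded , λ t → S-upper (proj₂ (proj₂ bounded))))
      where
      -- All numbers below some quotient M(x)/N(x), stated without division; the supremum is that of
      -- the quotients.
      S : ℝ → Set
      S t = ∃[ x ] ¬ (x ≋ 0⃗) × t * quad N x ≤ quad M x

      bounded : ∃[ b ] 0# ≤ b × (∀ x → quad M x ≤ b * quad N x)
      bounded = relatively-bounded M N-coercive

      S-upper : ∀ {e t} → (∀ x → quad M x ≤ e * quad N x) → S t → t ≤ e
      S-upper bound (x , x≉0 , h) = *-cancelʳ-≤ (coercive-pos N-coercive x≉0) (≤-trans h (bound x))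

      value : ∀ x → 0# < quad M x → ∃[ t ] 0# < t × t * quad N x ≈ quad M x
      value x h = quotient (quad M x) (coercive-pos N-coercive (quad-pos⇒nonzero h)) h

      t₀ : ℝ
      t₀ = proj₁ (value y My>0)
      t₀∈S : S t₀
      t₀∈S = y , quad-pos⇒nonzero My>0 , inj₂ (proj₂ (proj₂ (value y My>0)))

      finish : ∃[ s ] IsUpperBound S s × (∀ b → IsUpperBound S b → s ≤ b) →
               ∃[ ev ] 0# < ev × (∀ x → quad M x ≤ ev * quad N x)
                       × (∀ e → (∀ x → quad M x ≤ e * quad N x) → ev ≤ e)
      finish (ev , upper , least) = ev , ev>0 , bound , λ e h → least e (λ t → S-upper h)
        where
        ev>0 : 0# < ev
        ev>0 = <-≤-trans (proj₁ (proj₂ (value y My>0))) (upper t₀ t₀∈S)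
        bound : ∀ x → quad M x ≤ ev * quad N x
        -- Where M(x) ≤ 0 the right-hand side is already large enough; otherwise the quotient at x
        -- belongs to `S`.
        bound x = when-pos (*-nonneg (inj₁ ev>0) (coercive-nonneg N-coercive x)) λ h →
          ≤-respˡ (proj₂ (proj₂ (value x h))) (*-monoʳ-≤ (coercive-nonneg N-coercive x)
            (upper (proj₁ (value x h)) (x , quad-pos⇒nonzero h , inj₂ (proj₂ (proj₂ (value x h))))))

  -- If ev N − M were coercive, a smaller number would still bound the quotient.
  singular-at-maximum : ∀ {M N : Matrix n} {ev} → (∀ x → quad M x ≤ ev * quad N x) →
    (∀ e → (∀ x → quad M x ≤ e * quad N x) → ev ≤ e) → ¬ Coercive ((ev ⊛ N) ⊝ M)
  singular-at-maximum {n} {M} {N} {ev} upper least Q-coercive =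
    refute (relatively-bounded N Q-coercive)
    where
    Q : Matrix n
    Q = (ev ⊛ N) ⊝ M
    quad-Q : ∀ x → quad Q x ≈ ev * quad N x - quad M x
    quad-Q x = trans (quad-⊝ (ev ⊛ N) M x) (+-congʳ (quad-⊛ ev N x))
    Q-nonneg : ∀ x → 0# ≤ quad Q x
    Q-nonneg x = ≤-respʳ (sym (quad-Q x)) (≤-diff (upper x))

    gap : ∀ ε b q k → ε * ((b * k - q) + k) ≈ (1# + b) * ε * k - ε * q
    gap = solve 4 (λ e b q k → e :* ((b :* k :- q) :+ k)
      := (con (+ 1) :+ b) :* e :* k :- e :* q) refl
    rearrange : ∀ l e q m → (l * q - m) - e * q ≈ (l - e) * q - m
    rearrange = solve 4 (λ l e q m → (l :* q :- m) :- e :* q := (l :- e) :* q :- m) refl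
    shrink : ∀ l e → e ≈ l - (l - e)
    shrink = solve 2 (λ l e → e := l :- (l :- e)) refl

    refute : ¬ (∃[ b ] 0# ≤ b × (∀ x → quad N x ≤ b * quad Q x))
    refute (b , b≥0 , bound) = impossible (recip (+-pos-nonneg 0<1 b≥0))
      where
      -- ε = 1/(1 + b) rather than 1/b, since b may be zero. Then ε N(x) ≤ ε b Q(x) ≤ Q(x), where
      -- the last step uses Q ≥ 0.
      impossible : ¬ (∃[ ε ] 0# < ε × (1# + b) * ε ≈ 1#)
      impossible (ε , ε>0 , bε≈1) = <⇒≱ (<-via ε>0 (shrink ev ε)) (least (ev - ε) smaller)
        where
        ε-bound : ∀ x → ε * quad N x ≤ quad Q x
        ε-bound x = ≤-respʳ (trans (*-congʳ bε≈1) (*-identityˡ (quad Q x)))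
          (≤-via (*-nonneg (inj₁ ε>0) (+-nonneg (≤-diff (bound x)) (Q-nonneg x)))
                 (gap ε b (quad N x) (quad Q x)))
        smaller : ∀ x → quad M x ≤ (ev - ε) * quad N x
        smaller x = ≤-via (≤-diff (≤-respʳ (quad-Q x) (ε-bound x)))
                          (rearrange ev ε (quad N x) (quad M x))

  abstract
    -- At the supremum ev the form ev N - M is semidefinite but not coercive. The dichotomy supplies
    -- a nonzero vector on which it is at most 0; such a vector lies in the kernel, which is the
    -- eigenvector equation.
    generalised-eigenvector : ∀ {M N : Matrix n} → Symmetric M → Symmetric N → Coercive N →
      ∀ y → 0# < quad M y →
      ∃[ ev ] ∃[ u ] 0# < ev × ¬ (u ≋ 0⃗) × M *ᵥ u ≋ ev ⊙ (N *ᵥ u)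
    generalised-eigenvector {n} {M} {N} M-sym N-sym N-coercive y My>0 =
      at-maximum (maximal-rayleigh-quotient N-coercive y My>0)
      where
      at-maximum : (∃[ ev ] 0# < ev × (∀ x → quad M x ≤ ev * quad N x)
                            × (∀ e → (∀ x → quad M x ≤ e * quad N x) → ev ≤ e)) →
                   ∃[ ev ] ∃[ u ] 0# < ev × ¬ (u ≋ 0⃗) × M *ᵥ u ≋ ev ⊙ (N *ᵥ u)
      at-maximum (ev , ev>0 , upper , least) = conclude (coercive-or-not-definite Q Q-sym)
        where
        Q : Matrix n
        Q = (ev ⊛ N) ⊝ M
        Q-sym : Symmetric Q
        Q-sym = ⊝-sym (λ i j → *-congˡ (N-sym i j)) M-sym
        Q-nonneg : ∀ x → 0# ≤ quad Q x
        Q-nonneg x = ≤-respʳ (sym (trans (quad-⊝ (ev ⊛ N) M x) (+-congʳ (quad-⊛ ev N x)))) (≤-diff (upper x))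

        conclude : Coercive Q ⊎ (∃[ u ] ¬ (u ≋ 0⃗) × quad Q u ≤ 0#) →
                   ∃[ l ] ∃[ u ] 0# < l × ¬ (u ≋ 0⃗) × M *ᵥ u ≋ l ⊙ (N *ᵥ u)
        conclude (inj₁ c) = ⊥-elim (singular-at-maximum upper least c)
        conclude (inj₂ (u , u≉0 , h)) = ev , u , ev>0 , u≉0 , eq
          where
          Qu≋0 : Q *ᵥ u ≋ 0⃗
          Qu≋0 = semidefinite-kernel Q-sym Q-nonneg h
          eq : M *ᵥ u ≋ ev ⊙ (N *ᵥ u)
          eq i = begin
            (M *ᵥ u) i                              ≈⟨ +-identityˡ _ ⟨
            0# + (M *ᵥ u) i                         ≈⟨ +-congʳ (Qu≋0 i) ⟨
            (Q *ᵥ u) i + (M *ᵥ u) i                 ≈⟨ +-congʳ (⊝-*ᵥ (ev ⊛ N) M u i) ⟩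
            (((ev ⊛ N) *ᵥ u) i - (M *ᵥ u) i) + (M *ᵥ u) i
              ≈⟨ solve 2 (λ p m → (p :- m) :+ m := p) refl (((ev ⊛ N) *ᵥ u) i) ((M *ᵥ u) i) ⟩
            ((ev ⊛ N) *ᵥ u) i                       ≈⟨ ⊛-*ᵥ ev N u i ⟩
            ev * (N *ᵥ u) i                         ∎

-- Forms with exactly one positive eigenvalue.

module Hyperbolic (𝕜 : CompleteOrderedField) where

  open OrderedField 𝕜
  open QuadraticForm 𝕜
  open Eigenvalue 𝕜
  open Lorentzian 𝕜 using (ℝ^; Matrix; _≋_; 0⃗; _⊕_; _⊙_; _*ᵥ_; basis;
    ExactlyOnePositiveEigenvalue; Positive)

  private
    variable
      n : ℕ

  basis-diag : (i : Fin n) → basis i i ≈ 1#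
  basis-diag i with i ≟ᶠ i
  ... | yes _ = refl
  ... | no h  = ⊥-elim (h ≡.refl)

  basis-off-diag : {i j : Fin n} → i ≢ j → basis i j ≈ 0#
  basis-off-diag {i = i} {j} i≢j with i ≟ᶠ j
  ... | yes e = ⊥-elim (i≢j e)
  ... | no _  = refl

  sum-single : ∀ {t : Vector ℝ n} i → (∀ j → i ≢ j → t j ≈ 0#) → sum t ≈ t i
  sum-single {suc n} zero h =
    trans (+-congˡ (sum-0 (λ j → h (suc j) λ ()))) (+-identityʳ _)
  sum-single {suc n} (suc i) h =
    trans (+-cong (h zero λ ()) (sum-single i (λ j i≢j → h (suc j) λ { ≡.refl → i≢j ≡.refl })))
          (+-identityˡ _)

  sum-basis : ∀ (i : Fin n) (u : ℝ^ n) → sum (λ j → basis i j * u j) ≈ u i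
  sum-basis i u = trans
    (sum-single i (λ j i≢j → trans (*-congʳ (basis-off-diag i≢j)) (zeroˡ (u j))))
    (trans (*-congʳ (basis-diag i)) (*-identityˡ (u i)))

  diag : ℝ^ n → Matrix n
  diag ν i j = ν i * basis i j

  diag-sym : (ν : ℝ^ n) → Symmetric (diag ν)
  diag-sym ν i j with i ≟ᶠ j
  ... | yes ≡.refl = *-congˡ (sym (basis-diag i))
  ... | no i≢j = trans (zeroʳ _) (sym (trans (*-congˡ (basis-off-diag (λ e → i≢j (≡.sym e)))) (zeroʳ _)))

  diag-*ᵥ : ∀ (ν u : ℝ^ n) i → (diag ν *ᵥ u) i ≈ ν i * u i
  diag-*ᵥ {n} ν u i = begin
    sum (λ j → ν i * basis i j * u j)    ≈⟨ sum-cong-≋ (λ j → *-assoc (ν i) (basis i j) (u j)) ⟩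
    sum (λ j → ν i * (basis i j * u j))  ≈⟨ *-distribˡ-sum {n} (ν i) _ ⟨
    ν i * sum (λ j → basis i j * u j)    ≈⟨ *-congˡ (sum-basis i u) ⟩
    ν i * u i ∎

  quad-diag : ∀ (ν x : ℝ^ n) → quad (diag ν) x ≈ sum (λ i → ν i * (x i * x i))
  quad-diag ν x = sum-cong-≋ (λ i → trans (*-congˡ (diag-*ᵥ ν x i))
    (solve 2 (λ v x → x :* (v :* x) := v :* (x :* x)) refl (ν i) (x i)))

  diag-coercive : {ν : ℝ^ n} → Positive ν → Coercive (diag ν)
  diag-coercive {n} {ν} ν>0 = K , +-pos-nonneg 0<1 (sum-nonneg inv≥0) , λ x →
    ≤-respʳ (trans (sym (*-distribˡ-sum {n} K _)) (*-congˡ (sym (quad-diag ν x))))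
            (sum-mono (term x))
    where
    inv : ℝ^ n
    inv i = proj₁ (recip (ν>0 i))
    inv≥0 : ∀ i → 0# ≤ inv i
    inv≥0 i = inj₁ (proj₁ (proj₂ (recip (ν>0 i))))
    -- The sum of the 1/ν_i replaces their maximum, and the summand 1 keeps K positive in dimension
    -- zero.
    K = 1# + sum inv
    term : ∀ x i → x i * x i ≤ K * (ν i * (x i * x i))
    term x i = ≤-via (*-nonneg (+-nonneg (inj₁ 0<1) (≤-diff (sum-term inv≥0 i)))
                               (*-nonneg (inj₁ (ν>0 i)) (square-nonneg (x i)))) (begin
      (1# + (sum inv - inv i)) * (ν i * (x i * x i))
        ≈⟨ solve 4 (λ s v n x → (con (+ 1) :+ (s :- v)) :* (n :* x)
             := (con (+ 1) :+ s) :* (n :* x) :- n :* v :* x) refl (sum inv) (inv i) (ν i) (x i * x i) ⟩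
      K * (ν i * (x i * x i)) - ν i * inv i * (x i * x i)
        ≈⟨ +-congˡ (-‿cong (trans (*-congʳ (proj₂ (proj₂ (recip (ν>0 i))))) (*-identityˡ _))) ⟩
      K * (ν i * (x i * x i)) - x i * x i ∎)

  private
    ones : ℝ^ n
    ones _ = 1#

  eigenvector-of-positive : ∀ {M : Matrix n} → Symmetric M → ∀ y → 0# < quad M y →
    ∃[ ev ] ∃[ u ] 0# < ev × ¬ (u ≋ 0⃗) × M *ᵥ u ≋ ev ⊙ u
  eigenvector-of-positive {n} {M} M-sym y h =
    simplify (generalised-eigenvector M-sym (diag-sym ones) (diag-coercive (λ _ → 0<1)) y h)
    where
    simplify : ∃[ ev ] ∃[ u ] 0# < ev × ¬ (u ≋ 0⃗) × M *ᵥ u ≋ ev ⊙ (diag ones *ᵥ u) →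
               ∃[ ev ] ∃[ u ] 0# < ev × ¬ (u ≋ 0⃗) × M *ᵥ u ≋ ev ⊙ u
    simplify (ev , u , ev>0 , u≉0 , e) = ev , u , ev>0 , u≉0 ,
      λ i → trans (e i) (*-congˡ (trans (diag-*ᵥ ones u i) (*-identityˡ (u i))))

  -- B − c e eᵀ has no positive eigenvalue when e is the eigenvector of the
  -- positive eigenvalue c |e|².
  lorentzian-bound : ∀ {B : Matrix n} → Symmetric B → ExactlyOnePositiveEigenvalue B →
    ∃[ c ] ∃[ e ] ∀ x → quad B x ≤ c * (dot e x * dot e x)
  lorentzian-bound {n} {B} B-sym H = c , e , λ x → subtract (trans (quad-⊝ B (rank-one c e) x)
      (+-congˡ (-‿cong (quad-rank-one c e x)))) (≮⇒≥ (no-positive x))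
    where
    subtract : ∀ {q a b} → q ≈ a - b → q ≤ 0# → a ≤ b
    subtract {q} {a} {b} e h = ≤-via (≤-diff h) (trans (+-congˡ (-‿cong e))
      (solve 2 (λ a b → con (+ 0) :- (a :- b) := b :- a) refl a b))
    open ExactlyOnePositiveEigenvalue H renaming (eigenvector to e)
    r : ℝ
    r = proj₁ (recip (norm²-pos e (proj₁ isEigen)))
    ee·r≈1 : dot e e * r ≈ 1#
    ee·r≈1 = proj₂ (proj₂ (recip (norm²-pos e (proj₁ isEigen))))
    c : ℝ
    c = eigenvalue * r
    c·ee : c * dot e e ≈ eigenvalue
    c·ee = trans (solve 3 (λ l r q → l :* r :* q := l :* (q :* r)) refl eigenvalue r (dot e e))
                 (trans (*-congˡ ee·r≈1) (*-identityʳ _))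
    B′ : Matrix n
    B′ = B ⊝ rank-one c e
    B′-sym : Symmetric B′
    B′-sym = ⊝-sym B-sym (rank-one-sym c e)
    B′-*ᵥ : ∀ x i → (B′ *ᵥ x) i ≈ (B *ᵥ x) i - c * dot e x * e i
    B′-*ᵥ x i = trans (⊝-*ᵥ B (rank-one c e) x i) (+-congˡ (-‿cong (rank-one-*ᵥ c e x i)))
    B′e : ∀ i → (B′ *ᵥ e) i ≈ 0#
    B′e i = begin
      (B′ *ᵥ e) i                          ≈⟨ B′-*ᵥ e i ⟩
      (B *ᵥ e) i - c * dot e e * e i       ≈⟨ +-cong (proj₂ isEigen i) (-‿cong (*-congʳ c·ee)) ⟩
      eigenvalue * e i - eigenvalue * e i  ≈⟨ -‿inverseʳ (eigenvalue * e i) ⟩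
      0#                                   ∎
    -- An eigenvector u of `B′` with positive eigenvalue is orthogonal to e, because `B′` is
    -- symmetric and kills e. On such u the forms B and `B′` act alike, so u is an eigenvector of B,
    -- hence a multiple of e by simplicity, hence 0.
    no-positive : ∀ x → ¬ (0# < quad B′ x)
    no-positive x h = refute (eigenvector-of-positive B′-sym x h)
      where
      refute : ¬ (∃[ l ] ∃[ u ] 0# < l × ¬ (u ≋ 0⃗) × B′ *ᵥ u ≋ l ⊙ u)
      refute (l , u , l>0 , u≉0 , B′u) = u≉0 (λ i → trans (u≋te i) (trans (*-congʳ t≈0) (zeroˡ (e i))))
        where
        eu≈0 : dot e u ≈ 0#
        eu≈0 = *-cancel-0 (pos⇒≉0 l>0) (begin
          l * dot e u       ≈⟨ dot-scaleʳ l e u ⟨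
          dot e (l ⊙ u)     ≈⟨ dot-cong {u = e} (λ _ → refl) B′u ⟨
          dot e (B′ *ᵥ u)   ≈⟨ self-adjoint B′-sym e u ⟩
          dot u (B′ *ᵥ e)   ≈⟨ sum-0 (λ i → trans (*-congˡ (B′e i)) (zeroʳ (u i))) ⟩
          0#                ∎)
        Bu : B *ᵥ u ≋ l ⊙ u
        Bu i = begin
          (B *ᵥ u) i                       ≈⟨ solve 1 (λ y → y := y :- con (+ 0)) refl ((B *ᵥ u) i) ⟩
          (B *ᵥ u) i - 0#                  ≈⟨ +-congˡ (-‿cong (trans (*-congʳ (trans (*-congˡ eu≈0) (zeroʳ c))) (zeroˡ (e i)))) ⟨
          (B *ᵥ u) i - c * dot e u * e i   ≈⟨ B′-*ᵥ u i ⟨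
          (B′ *ᵥ u) i                      ≈⟨ B′u i ⟩
          l * u i                          ∎
        l≈ev : l ≈ eigenvalue
        l≈ev = unique l u l>0 (u≉0 , Bu)
        mult : ∃[ t ] u ≋ t ⊙ e
        mult = multiplicity u (u≉0 , λ i → trans (Bu i) (*-congʳ l≈ev))
        t : ℝ
        t = proj₁ mult
        u≋te : u ≋ t ⊙ e
        u≋te = proj₂ mult
        t≈0 : t ≈ 0#
        t≈0 = *-cancel-0 (pos⇒≉0 (norm²-pos e (proj₁ isEigen))) (begin
          dot e e * t      ≈⟨ *-comm _ t ⟩
          t * dot e e      ≈⟨ dot-scaleʳ t e e ⟨
          dot e (t ⊙ e)    ≈⟨ dot-cong {u = e} (λ _ → refl) u≋te ⟨
          dot e u          ≈⟨ eu≈0 ⟩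
          0#               ∎)

  private
    project : ∀ a r b → b * r ≈ 1# → 1# * a + - (a * r) * b ≈ 0#
    project a r b h = begin
      1# * a + - (a * r) * b  ≈⟨ solve 3 (λ a r b → con (+ 1) :* a :+ (:- (a :* r)) :* b := a :- a :* (b :* r)) refl a r b ⟩
      a - a * (b * r)         ≈⟨ +-congˡ (-‿cong (trans (*-congˡ h) (*-identityʳ a))) ⟩
      a - a                   ≈⟨ -‿inverseʳ a ⟩
      0#                      ∎

  -- For s = (e·x)/(e·p), the vector x − s p is orthogonal to e, so that
  -- B(x − s p) ≤ 0.
  reverse-cauchy-schwarz : ∀ {B : Matrix n} → Symmetric B → ExactlyOnePositiveEigenvalue B →
    ∀ {p} → 0# < quad B p → ∀ x → quad B x * quad B p ≤ dot x (B *ᵥ p) * dot x (B *ᵥ p)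
  reverse-cauchy-schwarz {n} {B} B-sym H {p} Bp>0 x = from-bound (lorentzian-bound B-sym H)
    where
    pp xx xp : ℝ
    pp = quad B p
    xx = quad B x
    xp = dot x (B *ᵥ p)
    vanish : ∀ {q c a} → q ≤ c * (a * a) → a ≈ 0# → q ≤ 0#
    vanish {q} {c} {a} h a≈0 = ≤-respʳ (trans (*-congˡ (trans (*-congʳ a≈0) (zeroˡ a))) (zeroʳ c)) h
    -- Holds for every s: the deviation of s from the B-orthogonal projection coefficient
    -- B(x,p)/B(p) shows up as a square, which has the favourable sign.
    square : ∀ pp xx xp s →
      pp * (0# - (1# * 1# * xx + (1# * - s + 1# * - s) * xp + - s * - s * pp)) + (xp - s * pp) * (xp - s * pp)
      ≈ xp * xp - xx * pp
    square = solve 4 (λ pp xx xp s →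
      pp :* (con (+ 0) :- (con (+ 1) :* con (+ 1) :* xx :+ (con (+ 1) :* (:- s) :+ con (+ 1) :* (:- s)) :* xp
        :+ (:- s) :* (:- s) :* pp)) :+ (xp :- s :* pp) :* (xp :- s :* pp)
      := xp :* xp :- xx :* pp) refl

    from-bound : ∃[ c ] ∃[ e ] (∀ x → quad B x ≤ c * (dot e x * dot e x)) → xx * pp ≤ xp * xp
    from-bound (c , e , bound) =
      -- If e·p were 0, the bound at p would give B(p) ≤ 0.
      from-inverse (inverse (dot e p) (λ ep≈0 → <⇒≱ Bp>0 (vanish (bound p) ep≈0)))
      where
      from-inverse : ∃[ r ] dot e p * r ≈ 1# → xx * pp ≤ xp * xp
      from-inverse (r , ep·r≈1) = ≤-via
        (+-nonneg (*-nonneg (inj₁ Bp>0) (≤-diff By≤0)) (square-nonneg (xp - s * pp)))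
        (trans (+-congʳ (*-congˡ (+-congˡ (-‿cong (quad-comb B-sym 1# (- s) x p))))) (square pp xx xp s))
        where
        s : ℝ
        s = dot e x * r
        y : ℝ^ n
        y = (1# ⊙ x) ⊕ ((- s) ⊙ p)
        ey≈0 : dot e y ≈ 0#
        ey≈0 = trans (dot-combʳ 1# (- s) e x p) (project (dot e x) r (dot e p) ep·r≈1)
        By≤0 : quad B y ≤ 0#
        By≤0 = vanish (bound y) ey≈0

  private
    -- The two vectors span a plane on which A is positive definite; it meets
    -- the hyperplane orthogonal to A v.
    orthogonal-eigenvectors : ∀ {A : Matrix n} → Symmetric A → ∀ {v} →
      (∀ x → dot x (A *ᵥ v) ≈ 0# → quad A x ≤ 0#) →
      ∀ {l e μ u} → 0# < l → ¬ (e ≋ 0⃗) → A *ᵥ e ≋ l ⊙ e → 0# < μ → A *ᵥ u ≋ μ ⊙ u →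
      dot e u ≈ 0# → u ≋ 0⃗
    orthogonal-eigenvectors {n} {A} A-sym {v} neg {l} {e} {μ} {u} l>0 e≉0 Ae μ>0 Au eu≈0 =
      -- Since e·Au = 0, the form at x is α² A(e) + β² A(u). It is at most 0 because x is orthogonal
      -- to Av. If u were nonzero, A(u) > 0 would force β = 0, so e itself would lie in the
      -- hyperplane, against A(e) > 0.
      norm²-zero u (≮⇒≥ λ uu>0 → <⇒≱ qe>0 (neg e (β≈0 (*-pos μ>0 uu>0))))
      where
      α β : ℝ
      α = dot u (A *ᵥ v)
      β = dot e (A *ᵥ v)
      x : ℝ^ n
      x = (α ⊙ e) ⊕ ((- β) ⊙ u)
      qe≈ : quad A e ≈ l * dot e e
      qe≈ = trans (dot-cong {u = e} (λ _ → refl) Ae) (dot-scaleʳ l e e)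
      qe>0 : 0# < quad A e
      qe>0 = <-respʳ (sym qe≈) (*-pos l>0 (norm²-pos e e≉0))
      qu≈ : quad A u ≈ μ * dot u u
      qu≈ = trans (dot-cong {u = u} (λ _ → refl) Au) (dot-scaleʳ μ u u)
      swap : ∀ a b → a * b + - b * a ≈ 0#
      swap = solve 2 (λ a b → a :* b :+ (:- b) :* a := con (+ 0)) refl
      x·Av≈0 : dot x (A *ᵥ v) ≈ 0#
      x·Av≈0 = trans (dot-combˡ α (- β) (A *ᵥ v) e u) (swap α β)
      eAu≈0 : dot e (A *ᵥ u) ≈ 0#
      eAu≈0 = trans (dot-cong {u = e} (λ _ → refl) Au)
        (trans (dot-scaleʳ μ e u) (trans (*-congˡ eu≈0) (zeroʳ μ)))
      expand : ∀ a b p k q → k ≈ 0# →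
        a * a * p + (a * - b + a * - b) * k + - b * - b * q ≈ a * a * p + b * b * q
      expand a b p k q k≈0 = trans (+-congʳ (+-congˡ (trans (*-congˡ k≈0) (zeroʳ _))))
        (solve 4 (λ a b p q → a :* a :* p :+ con (+ 0) :+ (:- b) :* (:- b) :* q
          := a :* a :* p :+ b :* b :* q) refl a b p q)
      qx≈ : quad A x ≈ α * α * quad A e + β * β * quad A u
      qx≈ = trans (quad-comb A-sym α (- β) e u) (expand α β _ _ _ eAu≈0)
      drop-left : ∀ {a b} → 0# ≤ a → a + b ≤ 0# → b ≤ 0#
      drop-left {a} {b} a≥0 h = ≤-trans (≤-via a≥0 (solve 2 (λ a b → a := (a :+ b) :- b) refl a b)) h
      β≈0 : 0# < μ * dot u u → β ≈ 0#
      β≈0 qu>0 = square-zero (≮⇒≥ λ β²>0 → <⇒≱ (*-pos β²>0 (<-respʳ (sym qu≈) qu>0))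
        (drop-left (*-nonneg (square-nonneg α) (inj₁ qe>0)) (≤-respˡ qx≈ (neg x x·Av≈0))))

  -- A(v) > 0 produces one positive eigenvector e. Eigenvectors for another eigenvalue are
  -- orthogonal to e by symmetry; for the same eigenvalue they become so after subtracting the
  -- projection to e. Two orthogonal ones cannot coexist, as their plane would meet the hyperplane.
  lorentzian-from-hyperplane : ∀ {A : Matrix n} → Symmetric A → ∀ {v} → 0# < quad A v →
    (∀ x → dot x (A *ᵥ v) ≈ 0# → quad A x ≤ 0#) → ExactlyOnePositiveEigenvalue A
  lorentzian-from-hyperplane {n} {A} A-sym {v} Av>0 neg = build (eigenvector-of-positive A-sym v Av>0)
    where
    build : ∃[ l ] ∃[ e ] 0# < l × ¬ (e ≋ 0⃗) × A *ᵥ e ≋ l ⊙ e → ExactlyOnePositiveEigenvalue A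
    build (l , e , l>0 , e≉0 , Ae) = record
      { eigenvalue = l
      ; positive = l>0
      ; eigenvector = e
      ; isEigen = e≉0 , Ae
      ; unique = unique
      ; multiplicity = mult
      }
      where
      orthogonal : ∀ {μ u} → 0# < μ → A *ᵥ u ≋ μ ⊙ u → dot e u ≈ 0# → u ≋ 0⃗
      orthogonal = orthogonal-eigenvectors A-sym neg l>0 e≉0 Ae

      unique : ∀ μ u → 0# < μ → ¬ (u ≋ 0⃗) × A *ᵥ u ≋ μ ⊙ u → μ ≈ l
      unique μ u μ>0 (u≉0 , Au) = decidable-stable (μ ≈? l) λ μ≉l →
        u≉0 (orthogonal μ>0 Au (distinct μ≉l μ·eu≈l·eu))
        where
        distinct : ∀ {a} → ¬ (μ ≈ l) → μ * a ≈ l * a → a ≈ 0#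
        distinct {a} μ≉l h = *-cancel-0 (λ z → μ≉l (begin
            μ            ≈⟨ solve 2 (λ m l → m := (m :- l) :+ l) refl μ l ⟩
            (μ - l) + l  ≈⟨ +-congʳ z ⟩
            0# + l       ≈⟨ +-identityˡ l ⟩
            l            ∎)) (begin
          (μ - l) * a    ≈⟨ solve 3 (λ m l x → (m :- l) :* x := m :* x :- l :* x) refl μ l a ⟩
          μ * a - l * a  ≈⟨ +-congʳ h ⟩
          l * a - l * a  ≈⟨ -‿inverseʳ (l * a) ⟩
          0#             ∎)
        μ·eu≈l·eu : μ * dot e u ≈ l * dot e u
        μ·eu≈l·eu = begin
          μ * dot e u       ≈⟨ dot-scaleʳ μ e u ⟨
          dot e (μ ⊙ u)     ≈⟨ dot-cong {u = e} (λ _ → refl) Au ⟨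
          dot e (A *ᵥ u)    ≈⟨ self-adjoint A-sym e u ⟩
          dot u (A *ᵥ e)    ≈⟨ dot-cong {u = u} (λ _ → refl) Ae ⟩
          dot u (l ⊙ e)     ≈⟨ dot-scaleʳ l u e ⟩
          l * dot u e       ≈⟨ *-congˡ (dot-comm u e) ⟩
          l * dot e u       ∎

      mult : ∀ u → ¬ (u ≋ 0⃗) × A *ᵥ u ≋ l ⊙ u → ∃[ t ] u ≋ t ⊙ e
      mult u (_ , Au) = t , λ i → undo (u i) (e i) (u′≋0 i)
        where
        r t : ℝ
        r = proj₁ (recip (norm²-pos e e≉0))
        t = dot e u * r
        u′ : ℝ^ n
        u′ = (1# ⊙ u) ⊕ ((- t) ⊙ e)
        undo : ∀ a b → 1# * a + - t * b ≈ 0# → a ≈ t * b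
        undo a b h = begin
          a                               ≈⟨ solve 3 (λ a t b → a := (con (+ 1) :* a :+ (:- t) :* b) :+ t :* b) refl a t b ⟩
          (1# * a + - t * b) + t * b      ≈⟨ +-congʳ h ⟩
          0# + t * b                      ≈⟨ +-identityˡ (t * b) ⟩
          t * b                           ∎
        combine : ∀ l u t e → 1# * (l * u) + - t * (l * e) ≈ l * (1# * u + - t * e)
        combine = solve 4 (λ l u t e → con (+ 1) :* (l :* u) :+ (:- t) :* (l :* e)
          := l :* (con (+ 1) :* u :+ (:- t) :* e)) refl
        Au′ : A *ᵥ u′ ≋ l ⊙ u′
        Au′ i = trans (*ᵥ-comb A 1# (- t) u e i)
          (trans (+-cong (*-congˡ (Au i)) (*-congˡ (Ae i))) (combine l (u i) t (e i)))
        u′≋0 : u′ ≋ 0⃗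
        u′≋0 = orthogonal l>0 Au′ (trans (dot-combʳ 1# (- t) e u e)
          (project (dot e u) r (dot e e) (proj₂ (proj₂ (recip (norm²-pos e e≉0))))))

-- The Perron-Frobenius argument and Bochner's inequality.

module Perron (𝕜 : CompleteOrderedField) where

  open OrderedField 𝕜
  open QuadraticForm 𝕜
  open Eigenvalue 𝕜
  open Hyperbolic 𝕜
  open Lorentzian 𝕜 using (ℝ^; Matrix; _≋_; 0⃗; _⊙_; _*ᵥ_;
    ExactlyOnePositiveEigenvalue; NonnegativeOffDiagonal; Irreducible; Positive)
  open RawSemiringOps (Semiring.rawSemiring semiring) using (product)

  private
    variable
      n : ℕ

  -- Expanding (w_i - w_j)² gives two square terms, equal by symmetry of H, and two cross terms,
  -- each giving H at the vector with entries p_i w_i. Diagonal entries meet the factor w_i - w_i =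
  -- 0, so nonnegative off-diagonal entries and positive p make every summand nonnegative.
  dirichlet-form : ∀ {H : Matrix n} → Symmetric H → ∀ (p w : ℝ^ n) →
    sum (λ i → sum (λ j → p i * p j * H i j * ((w i - w j) * (w i - w j)))) ≈
    (sum (λ i → w i * w i * (p i * (H *ᵥ p) i)) - quad H (λ i → p i * w i))
    + (sum (λ i → w i * w i * (p i * (H *ᵥ p) i)) - quad H (λ i → p i * w i))
  dirichlet-form {n} {H} H-sym p w = begin
    ∑∑ (λ i j → p i * p j * H i j * ((w i - w j) * (w i - w j)))
      ≈⟨ ∑∑-cong (λ i j → solve 5 (λ a b h x y → a :* b :* h :* ((x :- y) :* (x :- y))
           := ((x :* x) :* (a :* (h :* b)) :+ (:- con (+ 1)) :* ((a :* x) :* (h :* (b :* y))))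
              :+ ((y :* y) :* (b :* (h :* a)) :+ (:- con (+ 1)) :* ((a :* x) :* (h :* (b :* y)))))
           refl (p i) (p j) (H i j) (w i) (w j)) ⟩
    ∑∑ (λ i j → (D i j + - 1# * E i j) + (w j * w j * (p j * (H i j * p i)) + - 1# * E i j))
      ≈⟨ ∑∑-cong (λ i j → +-congˡ (+-congʳ (*-congˡ (*-congˡ (*-congʳ (H-sym i j)))))) ⟩
    ∑∑ (λ i j → (D i j + - 1# * E i j) + (D j i + - 1# * E i j))
      ≈⟨ ∑∑-+ (λ i j → D i j + - 1# * E i j) (λ i j → D j i + - 1# * E i j) ⟩
    ∑∑ (λ i j → D i j + - 1# * E i j) + ∑∑ (λ i j → D j i + - 1# * E i j)
      ≈⟨ +-cong (∑∑-+ D _) (∑∑-+ (λ i j → D j i) _) ⟩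
    (∑∑ D + ∑∑ (λ i j → - 1# * E i j)) + (∑∑ (λ i j → D j i) + ∑∑ (λ i j → - 1# * E i j))
      ≈⟨ +-cong (+-cong ∑∑D ∑∑E) (+-cong (trans (∑-comm {n} {n} _) ∑∑D) ∑∑E) ⟩
    (total + - 1# * q) + (total + - 1# * q)
      ≈⟨ solve 2 (λ t q → (t :+ (:- con (+ 1)) :* q) :+ (t :+ (:- con (+ 1)) :* q)
           := (t :- q) :+ (t :- q)) refl total q ⟩
    (total - q) + (total - q) ∎
    where
    ∑∑ : Matrix n → ℝ
    ∑∑ F = sum (λ i → sum (F i))
    ∑∑-cong : ∀ {F G : Matrix n} → (∀ i j → F i j ≈ G i j) → ∑∑ F ≈ ∑∑ G
    ∑∑-cong h = sum-cong-≋ (λ i → sum-cong-≋ (h i))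
    ∑∑-+ : ∀ F G → ∑∑ (λ i j → F i j + G i j) ≈ ∑∑ F + ∑∑ G
    ∑∑-+ F G = trans (sum-cong-≋ (λ i → ∑-distrib-+ (F i) (G i)))
                     (∑-distrib-+ {n} (λ i → sum (F i)) (λ i → sum (G i)))
    D E : Matrix n
    D i j = w i * w i * (p i * (H i j * p j))
    E i j = p i * w i * (H i j * (p j * w j))
    total q : ℝ
    total = sum (λ i → w i * w i * (p i * (H *ᵥ p) i))
    q = quad H (λ i → p i * w i)
    ∑∑D : ∑∑ D ≈ total
    ∑∑D = sum-cong-≋ (λ i → sym (trans (*-congˡ (*-distribˡ-sum {n} (p i) _)) (*-distribˡ-sum {n} (w i * w i) _)))
    ∑∑E : ∑∑ (λ i j → - 1# * E i j) ≈ - 1# * q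
    ∑∑E = sym (trans (*-distribˡ-sum {n} (- 1#) _) (sum-cong-≋ (λ i →
      trans (*-congˡ (*-distribˡ-sum {n} (p i * w i) _)) (*-distribˡ-sum {n} (- 1#) _))))

  -- Along a path from i to j consecutive indices differ, so each factor of the positive product is
  -- nonnegative, hence positive. The path thus consists of edges on which w does not change.
  irreducible-connected : ∀ {H : Matrix n} → NonnegativeOffDiagonal H → Irreducible H →
    ∀ (w : ℝ^ n) → (∀ i j → 0# < H i j → w i ≈ w j) → ∀ i j → w i ≈ w j
  irreducible-connected {n} {H} H≥0 H-irr w edge i j with i ≟ᶠ j
  ... | yes ≡.refl = refl
  ... | no i≢j with H-irr i j i≢j
  ... | ℓ , s , ≡.refl , ≡.refl , s-steps , s-pos = along ℓ s s-steps s-pos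
    where
    along : ∀ ℓ (s : Vector (Fin n) (suc ℓ)) → (∀ k → s (inject₁ k) ≢ s (suc k)) →
            0# < product (λ (k : Fin ℓ) → H (s (inject₁ k)) (s (suc k))) → w (s zero) ≈ w (s (fromℕ ℓ))
    along zero s _ _ = refl
    along (suc ℓ) s steps h with H≥0 _ _ (steps zero)
    ... | inj₂ e = ⊥-elim (<-irrefl (trans (sym (zeroˡ _)) (*-congʳ e)) h)
    ... | inj₁ a>0 = trans (edge _ _ a>0)
            (along ℓ (λ k → s (suc k)) (λ k → steps (suc k)) (*-cancelˡ-pos a>0 h))

  -- If H were positive somewhere on the hyperplane x·Hp = 0, the pencil of H
  -- and N = diag ((Hp)_i / p_i) would have an eigenvector u with positive
  -- eigenvalue l in that hyperplane. The hypothesis on H forces 1 ≤ l, and then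
  -- the Dirichlet form of u/p is at most 0, so that u is a multiple of p.
  perron : ∀ {H : Matrix n} → Symmetric H → NonnegativeOffDiagonal H → Irreducible H →
    ∀ {p s : ℝ^ n} → Positive p → Positive (H *ᵥ p) → (∀ i → (H *ᵥ p) i * s i ≈ 1#) →
    (∀ x → quad H x ≤ sum (λ i → p i * s i * ((H *ᵥ x) i * (H *ᵥ x) i))) →
    ∀ x → dot x (H *ᵥ p) ≈ 0# → quad H x ≤ 0#
  perron {n} {H} H-sym H≥0 H-irr {p} {s} p>0 r>0 rs≈1 bochner x x·r≈0 = ≮⇒≥ contradiction
    where
    r : ℝ^ n
    r = H *ᵥ p
    q : ℝ^ n
    q i = proj₁ (recip (p>0 i))
    q>0 : Positive q
    q>0 i = proj₁ (proj₂ (recip (p>0 i)))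
    pq≈1 : ∀ i → p i * q i ≈ 1#
    pq≈1 i = proj₂ (proj₂ (recip (p>0 i)))
    ν : ℝ^ n
    ν i = r i * q i
    ν>0 : Positive ν
    ν>0 i = *-pos (r>0 i) (q>0 i)

    -- Strict positivity of r·p requires a coordinate; in dimension zero H(x) > 0 is absurd.
    some-index : ∀ {m} {x : ℝ^ m} {K : Matrix m} → 0# < quad K x → Fin m
    some-index {zero}  h = ⊥-elim (<-irrefl refl h)
    some-index {suc m} h = zero

    rp>0 : Fin n → 0# < dot r p
    rp>0 i = <-≤-trans (*-pos (r>0 i) (p>0 i)) (sum-term (λ i → inj₁ (*-pos (r>0 i) (p>0 i))) i)

    contradiction : ¬ (0# < quad H x)
    contradiction Hx>0 = refute (generalised-eigenvector M-sym (diag-sym ν) (diag-coercive ν>0) x Mx>0)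
      where
      c : ℝ
      c = proj₁ (recip (rp>0 (some-index {n} {x} {H} Hx>0)))
      rp·c≈1 : dot r p * c ≈ 1#
      rp·c≈1 = proj₂ (proj₂ (recip (rp>0 (some-index {n} {x} {H} Hx>0))))
      -- With c = 1/(r·p) this deflation of H satisfies M p = 0 and agrees with H on vectors
      -- orthogonal to r; in particular M(x) = H(x) > 0.
      M : Matrix n
      M = H ⊝ rank-one c r
      M-sym : Symmetric M
      M-sym = ⊝-sym H-sym (rank-one-sym c r)
      Mx>0 : 0# < quad M x
      Mx>0 = <-respʳ (sym (trans (quad-⊝ H (rank-one c r) x) (+-congˡ (-‿cong (quad-rank-one c r x)))))
        (<-respʳ (vanish (quad H x) c (dot r x) (trans (dot-comm r x) x·r≈0)) Hx>0)
        where
        vanish : ∀ h c d → d ≈ 0# → h ≈ h - c * (d * d)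
        vanish h c d d≈0 = trans (solve 3 (λ h c d → h := h :- c :* (con (+ 0) :* d)) refl h c d)
          (+-congˡ (-‿cong (*-congˡ (*-congʳ (sym d≈0)))))
      M-*ᵥ : ∀ y i → (M *ᵥ y) i ≈ (H *ᵥ y) i - c * dot r y * r i
      M-*ᵥ y i = trans (⊝-*ᵥ H (rank-one c r) y i) (+-congˡ (-‿cong (rank-one-*ᵥ c r y i)))
      Mp : ∀ i → (M *ᵥ p) i ≈ 0#
      Mp i = begin
        (M *ᵥ p) i              ≈⟨ M-*ᵥ p i ⟩
        r i - c * dot r p * r i ≈⟨ +-congˡ (-‿cong (*-congʳ (trans (*-comm c (dot r p)) rp·c≈1))) ⟩
        r i - 1# * r i          ≈⟨ solve 1 (λ r → r :- con (+ 1) :* r := con (+ 0)) refl (r i) ⟩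
        0#                      ∎

      refute : ¬ (∃[ l ] ∃[ u ] 0# < l × ¬ (u ≋ 0⃗) × M *ᵥ u ≋ l ⊙ (diag ν *ᵥ u))
      refute (l , u , l>0 , u≉0 , Mu) = u≉0 u≋0
        where
        W : ℝ
        W = sum (λ i → ν i * (u i * u i))
        w : ℝ^ n
        w i = q i * u i
        pw≋u : ∀ i → p i * w i ≈ u i
        pw≋u i = trans (sym (*-assoc (p i) (q i) (u i))) (trans (*-congʳ (pq≈1 i)) (*-identityˡ (u i)))

        -- As r = ν p entrywise, l (r·u) = p·(l ν u) = p·Mu = u·Mp = 0.
        ru≈0 : dot r u ≈ 0#
        ru≈0 = *-cancel-0 (pos⇒≉0 l>0) (begin
          l * dot r u                        ≈⟨ *-distribˡ-sum {n} l _ ⟩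
          sum (λ i → l * (r i * u i))        ≈⟨ sum-cong-≋ (λ i → begin
            l * (r i * u i)                    ≈⟨ *-congˡ (*-congˡ (pw≋u i)) ⟨
            l * (r i * (p i * (q i * u i)))    ≈⟨ solve 5 (λ l r p q u → l :* (r :* (p :* (q :* u))) := p :* (l :* ((r :* q) :* u))) refl l (r i) (p i) (q i) (u i) ⟩
            p i * (l * (ν i * u i))            ≈⟨ *-congˡ (*-congˡ (diag-*ᵥ ν u i)) ⟨
            p i * (l * (diag ν *ᵥ u) i)        ≈⟨ *-congˡ (Mu i) ⟨
            p i * (M *ᵥ u) i                   ∎) ⟩
          dot p (M *ᵥ u)                     ≈⟨ self-adjoint M-sym p u ⟩
          dot u (M *ᵥ p)                     ≈⟨ sum-0 (λ i → trans (*-congˡ (Mp i)) (zeroʳ (u i))) ⟩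
          0#                                 ∎)

        Hu : ∀ i → (H *ᵥ u) i ≈ l * (ν i * u i)
        Hu i = begin
          (H *ᵥ u) i                        ≈⟨ solve 1 (λ y → y := y :- con (+ 0)) refl ((H *ᵥ u) i) ⟩
          (H *ᵥ u) i - 0#                   ≈⟨ +-congˡ (-‿cong (trans (*-congʳ (trans (*-congˡ ru≈0) (zeroʳ c))) (zeroˡ (r i)))) ⟨
          (H *ᵥ u) i - c * dot r u * r i    ≈⟨ M-*ᵥ u i ⟨
          (M *ᵥ u) i                        ≈⟨ Mu i ⟩
          l * (diag ν *ᵥ u) i               ≈⟨ *-congˡ (diag-*ᵥ ν u i) ⟩
          l * (ν i * u i)                   ∎

        quad-Hu : quad H u ≈ l * W
        quad-Hu = trans
          (sum-cong-≋ (λ i → trans (*-congˡ (Hu i))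
            (solve 3 (λ l v u → u :* (l :* (v :* u)) := l :* (v :* (u :* u))) refl l (ν i) (u i))))
          (sym (*-distribˡ-sum {n} l _))

        W-terms : ∀ i → 0# ≤ ν i * (u i * u i)
        W-terms i = *-nonneg (inj₁ (ν>0 i)) (square-nonneg (u i))
        W≥0 : 0# ≤ W
        W≥0 = sum-nonneg W-terms
        W>0 : 0# < W
        W>0 = ≰⇒> λ h → u≉0 λ i → square-zero (inj₂
          (*-cancel-0 (pos⇒≉0 (ν>0 i)) (nonneg-sum-0 W-terms h i)))

        -- p s ν² = ν, as ν = r/p and s = 1/r.
        bochner-u : sum (λ i → p i * s i * ((H *ᵥ u) i * (H *ᵥ u) i)) ≈ l * l * W
        bochner-u = trans (sum-cong-≋ (λ i → begin
          p i * s i * ((H *ᵥ u) i * (H *ᵥ u) i)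
            ≈⟨ *-congˡ (*-cong (Hu i) (Hu i)) ⟩
          p i * s i * (l * (ν i * u i) * (l * (ν i * u i)))
            ≈⟨ solve 6 (λ p s l r q u → p :* s :* (l :* (r :* q :* u) :* (l :* (r :* q :* u)))
                 := (p :* q) :* (r :* s) :* (l :* l :* (r :* q :* (u :* u)))) refl (p i) (s i) l (r i) (q i) (u i) ⟩
          (p i * q i) * (r i * s i) * (l * l * (ν i * (u i * u i)))
            ≈⟨ *-congʳ (trans (*-cong (pq≈1 i) (rs≈1 i)) (*-identityˡ 1#)) ⟩
          1# * (l * l * (ν i * (u i * u i)))
            ≈⟨ *-identityˡ _ ⟩
          l * l * (ν i * (u i * u i)) ∎)) (sym (*-distribˡ-sum {n} (l * l) _))

        -- Bochner's inequality at u reads l W ≤ l² W with l W > 0.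
        l≥1 : 0# ≤ l - 1#
        l≥1 = *-cancelˡ-nonneg (*-pos l>0 W>0) (≤-respʳ
          (solve 2 (λ l w → l :* l :* w :- l :* w := (l :* w) :* (l :- con (+ 1))) refl l W)
          (≤-diff (≤-respˡ quad-Hu (≤-respʳ bochner-u (bochner u)))))

        energy : ℝ
        energy = sum (λ i → sum (λ j → p i * p j * H i j * ((w i - w j) * (w i - w j))))
        -- The energy of w = u/p is 2(1 - l)W. With 1 ≤ l all its nonnegative summands must vanish.
        energy≈ : energy ≈ (W - l * W) + (W - l * W)
        energy≈ = trans (dirichlet-form H-sym p w) (+-cong half half)
          where
          half : sum (λ i → w i * w i * (p i * r i)) - quad H (λ i → p i * w i) ≈ W - l * W
          half = +-cong (sum-cong-≋ (λ i → begin
              w i * w i * (p i * r i)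
                ≈⟨ solve 4 (λ q u p r → q :* u :* (q :* u) :* (p :* r)
                     := (p :* q) :* (r :* q :* (u :* u))) refl (q i) (u i) (p i) (r i) ⟩
              (p i * q i) * (ν i * (u i * u i))  ≈⟨ *-congʳ (pq≈1 i) ⟩
              1# * (ν i * (u i * u i))           ≈⟨ *-identityˡ _ ⟩
              ν i * (u i * u i)                  ∎))
            (-‿cong (trans (quad-cong H pw≋u) quad-Hu))
        energy≤0 : energy ≤ 0#
        energy≤0 = ≤-respˡ (sym energy≈) (≤-via
          (+-nonneg (*-nonneg W≥0 l≥1) (*-nonneg W≥0 l≥1))
          (solve 2 (λ w l → w :* (l :- con (+ 1)) :+ w :* (l :- con (+ 1))
             := con (+ 0) :- ((w :- l :* w) :+ (w :- l :* w))) refl W l))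

        term≥0 : ∀ i j → 0# ≤ p i * p j * H i j * ((w i - w j) * (w i - w j))
        term≥0 i j = weighted (i ≟ᶠ j)
          where
          weighted : Dec (i ≡ j) → 0# ≤ p i * p j * H i j * ((w i - w j) * (w i - w j))
          weighted (yes ≡.refl) = inj₂ (solve 2 (λ a x → con (+ 0) := a :* ((x :- x) :* (x :- x))) refl
            (p i * p i * H i i) (w i))
          weighted (no i≢j) = *-nonneg (*-nonneg (inj₁ (*-pos (p>0 i) (p>0 j))) (H≥0 i j i≢j))
            (square-nonneg (w i - w j))

        edge : ∀ i j → 0# < H i j → w i ≈ w j
        edge i j h = begin
          w i                ≈⟨ solve 2 (λ a b → a := (a :- b) :+ b) refl (w i) (w j) ⟩
          (w i - w j) + w j  ≈⟨ +-congʳ (square-zero (inj₂ (*-cancel-0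
                                  (pos⇒≉0 (*-pos (*-pos (p>0 i) (p>0 j)) h)) term≈0))) ⟩
          0# + w j           ≈⟨ +-identityˡ _ ⟩
          w j                ∎
          where
          term≈0 : p i * p j * H i j * ((w i - w j) * (w i - w j)) ≈ 0#
          term≈0 = nonneg-sum-0 (term≥0 i)
            (inj₂ (nonneg-sum-0 (λ i → sum-nonneg (term≥0 i)) energy≤0 i)) j

        w-constant : ∀ i j → w i ≈ w j
        w-constant = irreducible-connected {H = H} H≥0 H-irr w edge

        u≋0 : u ≋ 0⃗
        u≋0 j = begin
          u j        ≈⟨ pw≋u j ⟨
          p j * w j  ≈⟨ *-congˡ (*-cancel-0 (pos⇒≉0 (rp>0 j)) rp·w≈0) ⟩
          p j * 0#   ≈⟨ zeroʳ _ ⟩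
          0#         ∎
          where
          -- For constant w the vector u is w_j p, so (r·p) w_j = r·u = 0.
          rp·w≈0 : dot r p * w j ≈ 0#
          rp·w≈0 = begin
            dot r p * w j                    ≈⟨ *-distribʳ-sum {n} (w j) _ ⟩
            sum (λ i → r i * p i * w j)      ≈⟨ sum-cong-≋ (λ i → trans (*-congˡ (w-constant j i))
                                                  (trans (*-assoc _ _ _) (*-congˡ (pw≋u i)))) ⟩
            dot r u                          ≈⟨ ru≈0 ⟩
            0#                               ∎

  -- A vanishing row i annihilates the first factor of every path leaving i. Irreducibility then
  -- leaves i as the only index, where A = 0 contradicts A(p) > 0. This excludes a vanishing partial
  -- derivative.
  irreducible-row-nonzero : ∀ {A : Matrix n} → Irreducible A → ∀ {p} → 0# < quad A p →
    ∀ i → ¬ (∀ j → A i j ≈ 0#)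
  irreducible-row-nonzero {n} {A} A-irr {p} Ap>0 i row≈0 =
    <-irrefl (sym (sum-0 (λ j → trans (*-congˡ (Ap≈0 j (i ≟ᶠ j))) (zeroʳ (p j))))) Ap>0
    where
    no-path : ∀ {j} → i ≢ j → ∀ ℓ (s : Vector (Fin n) (suc ℓ)) → s zero ≡ i → s (fromℕ ℓ) ≡ j →
              ¬ (0# < product (λ (k : Fin ℓ) → A (s (inject₁ k)) (s (suc k))))
    no-path i≢j zero    s ≡.refl e _ = i≢j e
    no-path i≢j (suc ℓ) s ≡.refl e h =
      <-irrefl (sym (trans (*-congʳ (row≈0 (s (suc zero)))) (zeroˡ _))) h

    Ap≈0 : ∀ j → Dec (i ≡ j) → (A *ᵥ p) j ≈ 0#
    Ap≈0 j (yes ≡.refl) = sum-0 (λ k → trans (*-congʳ (row≈0 k)) (zeroˡ (p k)))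
    Ap≈0 j (no i≢j) = let ℓ , s , s₀ , s₁ , _ , h = A-irr i j i≢j in
      ⊥-elim (no-path i≢j ℓ s s₀ s₁ h)

  -- Bochner's inequality: quad A x = Σ_k p_k T_k(x), and each T_k(x) is bounded
  -- through the reverse Cauchy–Schwarz inequality for T_k, where T_k(x, p) = (A x)_k.
  lorentzian-from-slices : ∀ {A : Matrix n} → Symmetric A → NonnegativeOffDiagonal A → Irreducible A →
    ∀ {p : ℝ^ n} → Positive p → 0# < quad A p →
    (T : Fin n → Matrix n) → (∀ i j k → T i j k ≈ T j i k) → (∀ i j k → T i j k ≈ T i k j) →
    (∀ i j → A i j ≈ sum (λ k → p k * T k i j)) →
    (∀ k → 0# < quad (T k) p) →
    (∀ k x → quad (T k) x * quad (T k) p ≤ dot x (T k *ᵥ p) * dot x (T k *ᵥ p)) →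
    ExactlyOnePositiveEigenvalue A
  lorentzian-from-slices {n} {A} A-sym A≥0 A-irr {p} p>0 Ap>0 T T-sym₁ T-sym₂ A≈T Tp>0 reverse-cs =
    lorentzian-from-hyperplane A-sym Ap>0
      (perron A-sym A≥0 A-irr {s = s} p>0 r>0 (λ i → proj₂ (proj₂ (recip (r>0 i)))) bochner)
    where
    -- Total symmetry of T lets the contraction with p be moved to the first index, where it
    -- produces A.
    T-p : ∀ k i → (T k *ᵥ p) i ≈ A k i
    T-p k i = trans (sum-cong-≋ (λ j → trans (*-comm _ _) (*-congˡ (begin
      T k i j  ≈⟨ T-sym₂ k i j ⟩
      T k j i  ≈⟨ T-sym₁ k j i ⟩
      T j k i  ∎)))) (sym (A≈T k i))

    dot-T-p : ∀ k x → dot x (T k *ᵥ p) ≈ (A *ᵥ x) k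
    dot-T-p k x = trans (dot-cong {u = x} (λ _ → refl) (T-p k)) (dot-comm x (A k))

    r>0 : Positive (A *ᵥ p)
    r>0 k = <-respʳ (dot-T-p k p) (Tp>0 k)
    s : ℝ^ n
    s i = proj₁ (recip (r>0 i))

    quad-T : ∀ x → quad A x ≈ sum (λ k → p k * quad (T k) x)
    quad-T x = begin
      quad A x
        ≈⟨ dot-cong {u = x} (λ _ → refl) A-*ᵥ ⟩
      sum (λ i → x i * sum (λ k → p k * (T k *ᵥ x) i))
        ≈⟨ sum-cong-≋ (λ i → trans (*-distribˡ-sum {n} (x i) _) (sum-cong-≋ (λ k →
             solve 3 (λ x p t → x :* (p :* t) := p :* (x :* t)) refl (x i) (p k) _))) ⟩
      sum (λ i → sum (λ k → p k * (x i * (T k *ᵥ x) i)))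
        ≈⟨ ∑-comm {n} {n} _ ⟩
      sum (λ k → sum (λ i → p k * (x i * (T k *ᵥ x) i)))
        ≈⟨ sum-cong-≋ (λ k → sym (*-distribˡ-sum {n} (p k) _)) ⟩
      sum (λ k → p k * quad (T k) x) ∎
      where
      A-*ᵥ : ∀ i → (A *ᵥ x) i ≈ sum (λ k → p k * (T k *ᵥ x) i)
      A-*ᵥ i = begin
        sum (λ j → A i j * x j)
          ≈⟨ sum-cong-≋ (λ j → trans (*-congʳ (A≈T i j)) (*-distribʳ-sum {n} (x j) _)) ⟩
        sum (λ j → sum (λ k → p k * T k i j * x j))
          ≈⟨ ∑-comm {n} {n} _ ⟩
        sum (λ k → sum (λ j → p k * T k i j * x j))
          ≈⟨ sum-cong-≋ (λ k → trans (sum-cong-≋ (λ j → *-assoc (p k) (T k i j) (x j)))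
               (sym (*-distribˡ-sum {n} (p k) _))) ⟩
        sum (λ k → p k * (T k *ᵥ x) i) ∎

    bochner : ∀ x → quad A x ≤ sum (λ k → p k * s k * ((A *ᵥ x) k * (A *ᵥ x) k))
    bochner x = ≤-respˡ (sym (quad-T x)) (sum-mono term)
      where
      term : ∀ k → p k * quad (T k) x ≤ p k * s k * ((A *ᵥ x) k * (A *ᵥ x) k)
      -- The reverse Cauchy-Schwarz inequality divided by T_k(p) = (Ap)_k, through its inverse s_k,
      -- and weighted by p_k > 0.
      term k = ≤-via (*-nonneg (inj₁ (*-pos (p>0 k) (proj₁ (proj₂ (recip (r>0 k))))))
                               (≤-diff (reverse-cs k x))) (begin
        p k * s k * (dot x (T k *ᵥ p) * dot x (T k *ᵥ p) - quad (T k) x * quad (T k) p)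
          ≈⟨ *-congˡ (+-cong (*-cong (dot-T-p k x) (dot-T-p k x)) (-‿cong (*-congˡ (dot-T-p k p)))) ⟩
        p k * s k * ((A *ᵥ x) k * (A *ᵥ x) k - quad (T k) x * (A *ᵥ p) k)
          ≈⟨ solve 5 (λ p s y q r → p :* s :* (y :- q :* r) := p :* s :* y :- p :* q :* (r :* s))
               refl (p k) (s k) _ (quad (T k) x) ((A *ᵥ p) k) ⟩
        p k * s k * ((A *ᵥ x) k * (A *ᵥ x) k) - p k * quad (T k) x * ((A *ᵥ p) k * s k)
          ≈⟨ +-congˡ (-‿cong (trans (*-congˡ (proj₂ (proj₂ (recip (r>0 k))))) (*-identityʳ _))) ⟩
        p k * s k * ((A *ᵥ x) k * (A *ᵥ x) k) - p k * quad (T k) x ∎)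

-- Formal polynomials, their values and their derivatives.

module Polynomial (𝕜 : CompleteOrderedField) where

  open OrderedField 𝕜
  open Hyperbolic 𝕜 using (sum-basis)
  open Lorentzian 𝕜 using (ℝ^; _⊕_; _⊙_; basis; Exponent; Poly; coeff; IsZero; ⟦_⟧; _∙_; ∂; D; D*)
  open RawSemiringOps (Semiring.rawSemiring semiring) using (product; _^_) renaming (_×_ to _·_)

  private
    variable
      n : ℕ

  monomial : Exponent n → ℝ^ n → ℝ
  monomial α x = product (λ i → x i ^ lookup α i)

  infix 4 _~_
  -- Equality as functions. Different lists may represent one polynomial, and identities such as
  -- commuting derivatives are only used after evaluation.
  _~_ : Poly n → Poly n → Set
  p ~ q = ∀ x → ⟦ p ⟧ x ≈ ⟦ q ⟧ x

  ⟦++⟧ : ∀ (p q : Poly n) x → ⟦ p ++ q ⟧ x ≈ ⟦ p ⟧ x + ⟦ q ⟧ x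
  ⟦++⟧ []            q x = sym (+-identityˡ _)
  ⟦++⟧ ((c , α) ∷ p) q x = trans (+-congˡ (⟦++⟧ p q x)) (sym (+-assoc _ _ _))

  ⟦∙⟧ : ∀ t (p : Poly n) x → ⟦ t ∙ p ⟧ x ≈ t * ⟦ p ⟧ x
  ⟦∙⟧ t []            x = sym (zeroʳ t)
  ⟦∙⟧ t ((c , α) ∷ p) x = trans (+-cong (*-assoc _ _ _) (⟦∙⟧ t p x)) (sym (distribˡ _ _ _))

  ⟦concat⟧ : ∀ {m} (F : Fin m → Poly n) x →
             ⟦ List.concat (List.tabulate F) ⟧ x ≈ sum (λ i → ⟦ F i ⟧ x)
  ⟦concat⟧ {m = zero}  F x = refl
  ⟦concat⟧ {m = suc m} F x =
    trans (⟦++⟧ (F zero) _ x) (+-congˡ (⟦concat⟧ (λ i → F (suc i)) x))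

  ⟦D⟧ : ∀ u (p : Poly n) x → ⟦ D u p ⟧ x ≈ sum (λ i → u i * ⟦ ∂ i p ⟧ x)
  ⟦D⟧ u p x = trans (⟦concat⟧ (λ i → u i ∙ ∂ i p) x) (sum-cong-≋ (λ i → ⟦∙⟧ (u i) (∂ i p) x))

  D-basis : ∀ i (p : Poly n) → D (basis i) p ~ ∂ i p
  D-basis i p x = trans (⟦D⟧ (basis i) p x) (sum-basis i (λ j → ⟦ ∂ j p ⟧ x))

  ·-assoc-* : ∀ m x y → m · (x * y) ≈ (m · x) * y
  ·-assoc-* zero    x y = sym (zeroˡ y)
  ·-assoc-* (suc m) x y = trans (+-congˡ (·-assoc-* m x y)) (sym (distribʳ y x _))

  ·-comm-* : ∀ m x y → m · (x * y) ≈ x * (m · y)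
  ·-comm-* zero    x y = sym (zeroʳ x)
  ·-comm-* (suc m) x y = trans (+-congˡ (·-comm-* m x y)) (sym (distribˡ x y _))

  ·-congʳ : ∀ m {x y} → x ≈ y → m · x ≈ m · y
  ·-congʳ zero    h = refl
  ·-congʳ (suc m) h = +-cong h (·-congʳ m h)

  ·-1 : ∀ m x → m · x ≈ (m · 1#) * x
  ·-1 m x = trans (·-congʳ m (sym (*-identityˡ x))) (·-assoc-* m 1# x)

  ·-comm : ∀ m k x → m · (k · x) ≈ k · (m · x)
  ·-comm m k x = begin
    m · (k · x)            ≈⟨ trans (·-1 m _) (*-congˡ (·-1 k x)) ⟩
    m · 1# * (k · 1# * x)  ≈⟨ solve 3 (λ m k x → m :* (k :* x) := k :* (m :* x)) refl (m · 1#) (k · 1#) x ⟩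
    k · 1# * (m · 1# * x)  ≈⟨ trans (·-1 k _) (*-congˡ (·-1 m x)) ⟨
    k · (m · x)            ∎

  ∂-∙ : ∀ i t (p : Poly n) → ∂ i (t ∙ p) ~ t ∙ ∂ i p
  ∂-∙ i t []            x = refl
  ∂-∙ i t ((c , α) ∷ p) x = +-cong (*-congʳ (·-comm-* (lookup α i) t c)) (∂-∙ i t p x)

  ∂-concat : ∀ {m} i (F : Fin m → Poly n) →
             ∂ i (List.concat (List.tabulate F)) ≡ List.concat (List.tabulate (λ j → ∂ i (F j)))
  ∂-concat {m = zero}  i F = ≡.refl
  ∂-concat {m = suc m} i F = ≡.trans (Listₚ.map-++ _ (F zero) _)
    (≡.cong (∂ i (F zero) ++_) (∂-concat i (λ j → F (suc j))))

  ⟦∂D⟧ : ∀ i u (p : Poly n) x → ⟦ ∂ i (D u p) ⟧ x ≈ sum (λ j → u j * ⟦ ∂ i (∂ j p) ⟧ x)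
  ⟦∂D⟧ i u p x = begin
    ⟦ ∂ i (D u p) ⟧ x
      ≡⟨ ≡.cong (λ q → ⟦ q ⟧ x) (∂-concat i (λ j → u j ∙ ∂ j p)) ⟩
    ⟦ List.concat (List.tabulate (λ j → ∂ i (u j ∙ ∂ j p))) ⟧ x
      ≈⟨ ⟦concat⟧ (λ j → ∂ i (u j ∙ ∂ j p)) x ⟩
    sum (λ j → ⟦ ∂ i (u j ∙ ∂ j p) ⟧ x)
      ≈⟨ sum-cong-≋ (λ j → trans (∂-∙ i (u j) (∂ j p) x) (⟦∙⟧ (u j) (∂ i (∂ j p)) x)) ⟩
    sum (λ j → u j * ⟦ ∂ i (∂ j p) ⟧ x) ∎

  ∂-comm : ∀ i j (p : Poly n) → ∂ i (∂ j p) ~ ∂ j (∂ i p)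
  ∂-comm i j [] x = refl
  ∂-comm i j ((c , α) ∷ p) x with i ≟ᶠ j
  ... | yes ≡.refl = refl
  ... | no i≢j = +-cong (*-cong coefficient (reflexive (≡.cong (λ β → monomial β x) exponent)))
                        (∂-comm i j p x)
    where
    j≢i : j ≢ i
    j≢i e = i≢j (≡.sym e)
    exponent : (α [ j ]%= pred) [ i ]%= pred ≡ (α [ i ]%= pred) [ j ]%= pred
    exponent = Vecₚ.updateAt-commutes i j i≢j α
    coefficient : lookup (α [ j ]%= pred) i · (lookup α j · c) ≈ lookup (α [ i ]%= pred) j · (lookup α i · c)
    coefficient = begin
      lookup (α [ j ]%= pred) i · (lookup α j · c)
        ≡⟨ ≡.cong (_· (lookup α j · c)) (Vecₚ.lookup∘updateAt′ i j i≢j α) ⟩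
      lookup α i · (lookup α j · c)
        ≈⟨ ·-comm (lookup α i) (lookup α j) c ⟩
      lookup α j · (lookup α i · c)
        ≡⟨ ≡.cong (_· (lookup α i · c)) (Vecₚ.lookup∘updateAt′ j i j≢i α) ⟨
      lookup (α [ i ]%= pred) j · (lookup α i · c) ∎

  -- Only small positive t matters for first-order coefficients, so the remainder is controlled on
  -- [0, 1]; a two-sided bound stands for the absolute value.
  Bounded : (ℝ → ℝ) → Set
  Bounded ρ = ∃[ K ] ∀ t → 0# ≤ t → t ≤ 1# → - K ≤ ρ t × ρ t ≤ K

  -- c² + 1 dominates both c and -c without a case distinction: 2(c² + 1 ± c) = (c ± 1)² + c² + 1.
  bounded-const : ∀ c → Bounded (λ _ → c)
  bounded-const c = c * c + 1# , λ t _ _ →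
      halve (≤-via (+-nonneg (square-nonneg (c + 1#)) (+-nonneg (square-nonneg c) (inj₁ 0<1)))
        (solve 1 (λ c → (c :+ con (+ 1)) :* (c :+ con (+ 1)) :+ (c :* c :+ con (+ 1))
            := (c :+ c) :- (:- (c :* c :+ con (+ 1)) :+ :- (c :* c :+ con (+ 1)))) refl c))
    , halve (≤-via (+-nonneg (square-nonneg (c - 1#)) (+-nonneg (square-nonneg c) (inj₁ 0<1)))
        (solve 1 (λ c → (c :- con (+ 1)) :* (c :- con (+ 1)) :+ (c :* c :+ con (+ 1))
            := ((c :* c :+ con (+ 1)) :+ (c :* c :+ con (+ 1))) :- (c :+ c)) refl c))
    where
    halve : ∀ {x y} → x + x ≤ y + y → x ≤ y
    halve {x} {y} h = ≤-undiff (halve-nonneg (≤-respʳ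
      (solve 2 (λ x y → (y :+ y) :- (x :+ x) := (y :- x) :+ (y :- x)) refl x y) (≤-diff h)))

  bounded-id : Bounded (λ t → t)
  bounded-id = 1# , λ t t≥0 t≤1 →
    ≤-trans (≤-via (inj₁ 0<1) (solve 1 (λ o → o := con (+ 0) :- (:- o)) refl 1#)) t≥0 , t≤1

  bounded-+ : ∀ {ρ σ} → Bounded ρ → Bounded σ → Bounded (λ t → ρ t + σ t)
  bounded-+ {ρ} {σ} (K , h) (L , k) = K + L , λ t t≥0 t≤1 →
    let a , b = h t t≥0 t≤1
        c , d = k t t≥0 t≤1
    in ≤-via (+-nonneg (≤-diff a) (≤-diff c))
         (solve 4 (λ r s K L → (r :- :- K) :+ (s :- :- L) := (r :+ s) :- :- (K :+ L)) refl (ρ t) (σ t) K L)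
     , ≤-via (+-nonneg (≤-diff b) (≤-diff d))
         (solve 4 (λ r s K L → (K :- r) :+ (L :- s) := (K :+ L) :- (r :+ s)) refl (ρ t) (σ t) K L)

  -- 2(KL + ρσ) = (K + ρ)(L + σ) + (K − ρ)(L − σ), and similarly for KL − ρσ.
  bounded-* : ∀ {ρ σ} → Bounded ρ → Bounded σ → Bounded (λ t → ρ t * σ t)
  bounded-* {ρ} {σ} (K , h) (L , k) = K * L , λ t t≥0 t≤1 →
    let a , b = h t t≥0 t≤1
        c , d = k t t≥0 t≤1
    in ≤-undiff (halve-nonneg (≤-respʳ
         (solve 4 (λ r s K L → (r :- :- K) :* (s :- :- L) :+ (K :- r) :* (L :- s)
            := (r :* s :- :- (K :* L)) :+ (r :* s :- :- (K :* L))) refl (ρ t) (σ t) K L)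
         (+-nonneg (*-nonneg (≤-diff a) (≤-diff c)) (*-nonneg (≤-diff b) (≤-diff d)))))
     , ≤-undiff (halve-nonneg (≤-respʳ
         (solve 4 (λ r s K L → (r :- :- K) :* (L :- s) :+ (K :- r) :* (s :- :- L)
            := (K :* L :- r :* s) :+ (K :* L :- r :* s)) refl (ρ t) (σ t) K L)
         (+-nonneg (*-nonneg (≤-diff a) (≤-diff d)) (*-nonneg (≤-diff b) (≤-diff c)))))

  -- φ(t) = c + a t + O(t²) as t → 0⁺, in algebraic form.
  Expansion : (ℝ → ℝ) → ℝ → ℝ → Set
  Expansion φ c a = ∃[ ρ ] Bounded ρ × (∀ t → φ t ≈ c + t * (a + t * ρ t))

  expansion-cong : ∀ {φ c c′ a a′} → c ≈ c′ → a ≈ a′ → Expansion φ c a → Expansion φ c′ a′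
  expansion-cong p q (ρ , b , h) = ρ , b , λ t → trans (h t) (+-cong p (*-congˡ (+-congʳ q)))

  expansion-linear : ∀ c a → Expansion (λ t → c + t * a) c a
  expansion-linear c a = (λ _ → 0#) , bounded-const 0# , λ t →
    solve 3 (λ c a t → c :+ t :* a := c :+ t :* (a :+ t :* con (+ 0))) refl c a t

  expansion-const : ∀ c → Expansion (λ _ → c) c 0#
  expansion-const c = (λ _ → 0#) , bounded-const 0# , λ t →
    solve 2 (λ c t → c := c :+ t :* (con (+ 0) :+ t :* con (+ 0))) refl c t

  expansion-+ : ∀ {φ ψ c d a b} → Expansion φ c a → Expansion ψ d b →
                Expansion (λ t → φ t + ψ t) (c + d) (a + b)
  expansion-+ {c = c} {d} {a} {b} (ρ , Bρ , h) (σ , Bσ , k) =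
    (λ t → ρ t + σ t) , bounded-+ Bρ Bσ , λ t → trans (+-cong (h t) (k t))
      (solve 7 (λ c d a b t r s → (c :+ t :* (a :+ t :* r)) :+ (d :+ t :* (b :+ t :* s))
         := (c :+ d) :+ t :* ((a :+ b) :+ t :* (r :+ s))) refl c d a b t (ρ t) (σ t))

  expansion-* : ∀ {φ ψ c d a b} → Expansion φ c a → Expansion ψ d b →
                Expansion (λ t → φ t * ψ t) (c * d) (a * d + c * b)
  expansion-* {c = c} {d} {a} {b} (ρ , Bρ , h) (σ , Bσ , k) =
    (λ t → (c * σ t + d * ρ t) + (a + t * ρ t) * (b + t * σ t)) ,
    bounded-+ (bounded-+ (bounded-* (bounded-const c) Bσ) (bounded-* (bounded-const d) Bρ))
      (bounded-* (bounded-+ (bounded-const a) (bounded-* bounded-id Bρ))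
                 (bounded-+ (bounded-const b) (bounded-* bounded-id Bσ))) ,
    λ t → trans (*-cong (h t) (k t))
      (solve 7 (λ c d a b t r s → (c :+ t :* (a :+ t :* r)) :* (d :+ t :* (b :+ t :* s))
         := c :* d :+ t :* ((a :* d :+ c :* b) :+ t :* ((c :* s :+ d :* r) :+ (a :+ t :* r) :* (b :+ t :* s))))
         refl c d a b t (ρ t) (σ t))

  abstract
    -- The choice t = b/(1 + b + K) meets both requirements at once.
    small : ∀ {b K} → 0# < b → 0# ≤ K → ∃[ t ] 0# < t × t ≤ 1# × t * K < b
    small {b} {K} b>0 K≥0 with recip (+-pos-nonneg (+-pos-nonneg 0<1 (inj₁ b>0)) K≥0)
    ... | r , r>0 , e = b * r , *-pos b>0 r>0 ,
        ≤-via (*-nonneg (inj₁ r>0) (+-nonneg (inj₁ 0<1) K≥0)) (begin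
          r * (1# + K)                     ≈⟨ solve 3 (λ b K r → r :* (con (+ 1) :+ K) := (con (+ 1) :+ b :+ K) :* r :- b :* r) refl b K r ⟩
          (1# + b + K) * r - b * r         ≈⟨ +-congʳ e ⟩
          1# - b * r                       ∎) ,
        <-via (*-pos b>0 (*-pos r>0 (+-pos-nonneg 0<1 (inj₁ b>0)))) (begin
          b * (r * (1# + b))               ≈⟨ solve 3 (λ b K r → b :* (r :* (con (+ 1) :+ b)) := b :* ((con (+ 1) :+ b :+ K) :* r) :- b :* r :* K) refl b K r ⟩
          b * ((1# + b + K) * r) - b * r * K ≈⟨ +-congʳ (trans (*-congˡ e) (*-identityʳ b)) ⟩
          b - b * r * K                    ∎)

  -- Constancy gives a = -t ρ(t) for every t > 0, hence |a| ≤ t K for 0 < t ≤ 1. A nonzero a is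
  -- refuted by t small enough, in place of a limit.
  expansion-unique : ∀ {φ c a} → Expansion φ c a → (∀ t → 0# < t → φ t ≈ c) → a ≈ 0#
  expansion-unique {φ} {c} {a} (ρ , (K , bound) , h) const =
    ≤-antisym (≮⇒≥ not-pos) (≮⇒≥ not-neg)
    where
    K≥0 : 0# ≤ K
    K≥0 = let l , u = bound 0# ≤-refl (inj₁ 0<1) in
      halve-nonneg (≤-respʳ (solve 2 (λ K r → (r :- :- K) :+ (K :- r) := K :+ K) refl K (ρ 0#))
        (+-nonneg (≤-diff l) (≤-diff u)))
    root : ∀ t → 0# < t → a + t * ρ t ≈ 0#
    root t t>0 = *-cancel-0 (pos⇒≉0 t>0) (begin
      t * (a + t * ρ t)            ≈⟨ solve 2 (λ y c → y := (c :+ y) :- c) refl _ c ⟩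
      (c + t * (a + t * ρ t)) - c  ≈⟨ +-congʳ (h t) ⟨
      φ t - c                      ≈⟨ +-congʳ (const t t>0) ⟩
      c - c                        ≈⟨ -‿inverseʳ c ⟩
      0#                           ∎)
    not-pos : ¬ (0# < a)
    not-pos a>0 with small a>0 K≥0
    ... | t , t>0 , t≤1 , tK<a = <⇒≱ tK<a (≤-via
      (*-nonneg (inj₁ t>0) (≤-diff (proj₁ (bound t (inj₁ t>0) t≤1)))) (begin
        t * (ρ t - - K)                ≈⟨ solve 4 (λ t r K a → t :* (r :- :- K) := (t :* K :- a) :+ (a :+ t :* r)) refl t (ρ t) K a ⟩
        (t * K - a) + (a + t * ρ t)    ≈⟨ +-congˡ (root t t>0) ⟩
        (t * K - a) + 0#               ≈⟨ +-identityʳ _ ⟩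
        t * K - a                      ∎))
    not-neg : ¬ (a < 0#)
    not-neg a<0 with small (neg-pos a<0) K≥0
    ... | t , t>0 , t≤1 , tK<-a = <⇒≱ tK<-a (≤-via
      (*-nonneg (inj₁ t>0) (≤-diff (proj₂ (bound t (inj₁ t>0) t≤1)))) (begin
        t * (K - ρ t)                    ≈⟨ solve 4 (λ t r K a → t :* (K :- r) := (t :* K :- :- a) :- (a :+ t :* r)) refl t (ρ t) K a ⟩
        (t * K - - a) - (a + t * ρ t)    ≈⟨ +-congˡ (-‿cong (root t t>0)) ⟩
        (t * K - - a) - 0#               ≈⟨ trans (+-congˡ -0#≈0#) (+-identityʳ _) ⟩
        t * K - - a                      ∎))

  expansion-^ : ∀ x u k → Expansion (λ t → (x + t * u) ^ k) (x ^ k) (u * (k · (x ^ pred k)))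
  expansion-^ x u zero = expansion-cong refl (sym (zeroʳ u)) (expansion-const 1#)
  expansion-^ x u (suc k) = expansion-cong refl (rule k) (expansion-* (expansion-linear x u) (expansion-^ x u k))
    where
    rule : ∀ k → u * x ^ k + x * (u * (k · (x ^ pred k))) ≈ u * (suc k · (x ^ k))
    rule zero = solve 2 (λ u x → u :* con (+ 1) :+ x :* (u :* con (+ 0)) := u :* (con (+ 1) :+ con (+ 0))) refl u x
    rule (suc k) = trans (+-congˡ (trans
        (solve 3 (λ x u y → x :* (u :* y) := u :* (x :* y)) refl x u _)
        (*-congˡ (sym (·-comm-* (suc k) x (x ^ k)))))) (sym (distribˡ u _ _))

  expansion-monomial : ∀ (α : Exponent n) x u →
    Expansion (λ t → monomial α (x ⊕ (t ⊙ u))) (monomial α x)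
              (sum (λ i → u i * (lookup α i · monomial (α [ i ]%= pred) x)))
  expansion-monomial Vec.[] x u = expansion-const 1#
  expansion-monomial {suc n} (a Vec.∷ α) x u = expansion-cong refl rule
    (expansion-* (expansion-^ (x zero) (u zero) a) (expansion-monomial α (λ i → x (suc i)) (λ i → u (suc i))))
    where
    xr = λ i → x (suc i)
    m = monomial α xr
    rule : u zero * (a · (x zero ^ pred a)) * m
           + x zero ^ a * sum (λ i → u (suc i) * (lookup α i · monomial (α [ i ]%= pred) xr)) ≈
           u zero * (a · (x zero ^ pred a * m))
           + sum (λ i → u (suc i) * (lookup α i · (x zero ^ a * monomial (α [ i ]%= pred) xr)))
    rule = +-cong (trans (*-assoc _ _ _) (*-congˡ (sym (·-assoc-* a _ m))))
      (trans (*-distribˡ-sum {n} (x zero ^ a) _) (sum-cong-≋ (λ i → trans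
        (solve 3 (λ y u z → y :* (u :* z) := u :* (y :* z)) refl (x zero ^ a) (u (suc i)) _)
        (*-congˡ (sym (·-comm-* (lookup α i) (x zero ^ a) _))))))

  -- The formal derivative is the true first-order coefficient of the values. This is the bridge by
  -- which facts about values reach `D` and `∂`.
  expansion-poly : ∀ (p : Poly n) x u →
    Expansion (λ t → ⟦ p ⟧ (x ⊕ (t ⊙ u))) (⟦ p ⟧ x) (⟦ D u p ⟧ x)
  expansion-poly p x u = expansion-cong refl (sym (⟦D⟧ u p x)) (go p)
    where
    go : ∀ p → Expansion (λ t → ⟦ p ⟧ (x ⊕ (t ⊙ u))) (⟦ p ⟧ x) (sum (λ i → u i * ⟦ ∂ i p ⟧ x))
    go [] = expansion-cong refl (sym (sum-0 (λ i → zeroʳ (u i)))) (expansion-const 0#)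
    go ((c , α) ∷ p) = expansion-cong refl rule
      (expansion-+ (expansion-* (expansion-const c) (expansion-monomial α x u)) (go p))
      where
      m = monomial α x
      ∂m = λ i → monomial (α [ i ]%= pred) x
      rule : (0# * m + c * sum (λ i → u i * (lookup α i · ∂m i))) + sum (λ i → u i * ⟦ ∂ i p ⟧ x) ≈
             sum (λ i → u i * ((lookup α i · c) * ∂m i + ⟦ ∂ i p ⟧ x))
      rule = begin
        (0# * m + c * sum (λ i → u i * (lookup α i · ∂m i))) + sum (λ i → u i * ⟦ ∂ i p ⟧ x)
          ≈⟨ +-congʳ (trans (+-congʳ (zeroˡ m)) (+-identityˡ _)) ⟩
        c * sum (λ i → u i * (lookup α i · ∂m i)) + sum (λ i → u i * ⟦ ∂ i p ⟧ x)
          ≈⟨ +-congʳ (*-distribˡ-sum c (λ i → u i * (lookup α i · ∂m i))) ⟩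
        sum (λ i → c * (u i * (lookup α i · ∂m i))) + sum (λ i → u i * ⟦ ∂ i p ⟧ x)
          ≈⟨ ∑-distrib-+ (λ i → c * (u i * (lookup α i · ∂m i))) _ ⟨
        sum (λ i → c * (u i * (lookup α i · ∂m i)) + u i * ⟦ ∂ i p ⟧ x)
          ≈⟨ sum-cong-≋ (λ i → trans (+-congʳ (trans
               (solve 3 (λ c u y → c :* (u :* y) := u :* (c :* y)) refl c (u i) _)
               (*-congˡ (trans (sym (·-comm-* (lookup α i) c (∂m i))) (·-assoc-* (lookup α i) c (∂m i))))))
               (sym (distribˡ (u i) _ _))) ⟩
        sum (λ i → u i * ((lookup α i · c) * ∂m i + ⟦ ∂ i p ⟧ x)) ∎

  D-zero : ∀ u (p : Poly n) → (∀ x t → 0# < t → ⟦ p ⟧ (x ⊕ (t ⊙ u)) ≈ ⟦ p ⟧ x) → D u p ~ []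
  D-zero u p h x = expansion-unique (expansion-poly p x u) (h x)

  ∂-zero : ∀ i {p : Poly n} → p ~ [] → ∂ i p ~ []
  ∂-zero i {p} p~0 x = trans (sym (D-basis i p x)) (D-zero (basis i) p (λ x t _ → trans (p~0 _) (sym (p~0 x))) x)

  -- `∂` is defined on lists of terms, so respecting equality of functions needs proof: p - q
  -- vanishes everywhere, hence is constant along each axis, hence has derivative zero.
  ∂-cong : ∀ i {p q : Poly n} → p ~ q → ∂ i p ~ ∂ i q
  ∂-cong i {p} {q} p~q x = begin
    ⟦ ∂ i p ⟧ x
      ≈⟨ solve 2 (λ a b → a := (a :+ (:- con (+ 1)) :* b) :+ b) refl _ (⟦ ∂ i q ⟧ x) ⟩
    (⟦ ∂ i p ⟧ x + - 1# * ⟦ ∂ i q ⟧ x) + ⟦ ∂ i q ⟧ x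
      ≈⟨ +-congʳ (+-congˡ (trans (sym (⟦∙⟧ (- 1#) (∂ i q) x)) (sym (∂-∙ i (- 1#) q x)))) ⟩
    (⟦ ∂ i p ⟧ x + ⟦ ∂ i (- 1# ∙ q) ⟧ x) + ⟦ ∂ i q ⟧ x
      ≈⟨ +-congʳ (⟦++⟧ (∂ i p) _ x) ⟨
    ⟦ ∂ i p ++ ∂ i (- 1# ∙ q) ⟧ x + ⟦ ∂ i q ⟧ x
      ≡⟨ ≡.cong (λ r → ⟦ r ⟧ x + ⟦ ∂ i q ⟧ x) (≡.sym (Listₚ.map-++ _ p (- 1# ∙ q))) ⟩
    ⟦ ∂ i (p ++ - 1# ∙ q) ⟧ x + ⟦ ∂ i q ⟧ x
      ≈⟨ +-congʳ (∂-zero i {p ++ - 1# ∙ q} difference x) ⟩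
    0# + ⟦ ∂ i q ⟧ x
      ≈⟨ +-identityˡ _ ⟩
    ⟦ ∂ i q ⟧ x ∎
    where
    difference : p ++ - 1# ∙ q ~ []
    difference y = trans (⟦++⟧ p _ y) (trans (+-cong (p~q y) (⟦∙⟧ (- 1#) q y))
      (solve 1 (λ a → a :+ (:- con (+ 1)) :* a := con (+ 0)) refl (⟦ q ⟧ y)))

  D-cong : ∀ u {p q : Poly n} → p ~ q → D u p ~ D u q
  D-cong u {p} {q} h x = trans (⟦D⟧ u p x)
    (trans (sum-cong-≋ (λ i → *-congˡ (∂-cong i {p} {q} h x))) (sym (⟦D⟧ u q x)))

  ∂-D-comm : ∀ i u (p : Poly n) → ∂ i (D u p) ~ D u (∂ i p)
  ∂-D-comm i u p x = trans (⟦∂D⟧ i u p x)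
    (trans (sum-cong-≋ (λ j → *-congˡ (∂-comm i j p x))) (sym (⟦D⟧ u (∂ i p) x)))

  D-comm : ∀ u v (p : Poly n) → D u (D v p) ~ D v (D u p)
  D-comm {n} u v p x = begin
    ⟦ D u (D v p) ⟧ x
      ≈⟨ expand u v ⟩
    sum (λ i → sum (λ j → u i * (v j * ⟦ ∂ i (∂ j p) ⟧ x)))
      ≈⟨ ∑-comm {n} {n} _ ⟩
    sum (λ j → sum (λ i → u i * (v j * ⟦ ∂ i (∂ j p) ⟧ x)))
      ≈⟨ sum-cong-≋ (λ j → sum-cong-≋ (λ i → trans (*-congˡ (*-congˡ (∂-comm i j p x)))
           (solve 3 (λ a b c → a :* (b :* c) := b :* (a :* c)) refl (u i) (v j) _))) ⟩
    sum (λ j → sum (λ i → v j * (u i * ⟦ ∂ j (∂ i p) ⟧ x)))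
      ≈⟨ expand v u ⟨
    ⟦ D v (D u p) ⟧ x ∎
    where
    expand : ∀ u v → ⟦ D u (D v p) ⟧ x ≈ sum (λ i → sum (λ j → u i * (v j * ⟦ ∂ i (∂ j p) ⟧ x)))
    expand u v = trans (⟦D⟧ u (D v p) x) (sum-cong-≋ (λ i →
      trans (*-congˡ (⟦∂D⟧ i v p x)) (*-distribˡ-sum {n} (u i) _)))

  D-zero-poly : ∀ u → D {n} u [] ~ []
  D-zero-poly u x = trans (⟦D⟧ u [] x) (sum-0 (λ i → zeroʳ (u i)))

  D*-zero : ∀ {k} (vs : Vector (ℝ^ n) k) {p : Poly n} → p ~ [] → D* vs p ~ []
  D*-zero {k = zero}  vs h = h
  D*-zero {k = suc k} vs {p} h x = trans
    (D-cong (vs zero) {D* (Vector.tail vs) p} {[]} (D*-zero (Vector.tail vs) {p} h) x)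
    (D-zero-poly (vs zero) x)

  ∂-D*-comm : ∀ {k} i (vs : Vector (ℝ^ n) k) (p : Poly n) → ∂ i (D* vs p) ~ D* vs (∂ i p)
  ∂-D*-comm {k = zero}  i vs p x = refl
  ∂-D*-comm {k = suc k} i vs p x = trans
    (∂-D-comm i (vs zero) (D* (Vector.tail vs) p) x)
    (D-cong (vs zero) {∂ i (D* (Vector.tail vs) p)} {D* (Vector.tail vs) (∂ i p)}
      (∂-D*-comm i (Vector.tail vs) p) x)

  D-D*-comm : ∀ {k} u (vs : Vector (ℝ^ n) k) (p : Poly n) → D u (D* vs p) ~ D* vs (D u p)
  D-D*-comm {k = zero}  u vs p x = refl
  D-D*-comm {k = suc k} u vs p x = trans
    (D-comm u (vs zero) (D* (Vector.tail vs) p) x)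
    (D-cong (vs zero) {D u (D* (Vector.tail vs) p)} {D* (Vector.tail vs) (D u p)}
      (D-D*-comm u (Vector.tail vs) p) x)

  private
    _≟_ : (α β : Exponent n) → Dec (α ≡ β)
    _≟_ = Vecₚ.≡-dec ℕₚ._≟_

    without : Exponent n → Poly n → Poly n
    without α = List.filter (λ t → ¬? (proj₂ t ≟ α))

    collect : ∀ α (p : Poly n) x → ⟦ p ⟧ x ≈ coeff p α * monomial α x + ⟦ without α p ⟧ x
    collect α [] x = solve 1 (λ m → con (+ 0) := con (+ 0) :* m :+ con (+ 0)) refl (monomial α x)
    collect α ((c , β) ∷ p) x with β ≟ α
    ... | yes ≡.refl = trans (+-congˡ (collect α p x))
          (solve 4 (λ c m k r → c :* m :+ (k :* m :+ r) := (c :+ k) :* m :+ r) refl c _ _ _)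
    ... | no _ = trans (+-congˡ (collect α p x))
          (solve 4 (λ a m k r → a :+ (k :* m :+ r) := (con (+ 0) :+ k) :* m :+ (a :+ r)) refl _ _ _ _)

    coeff-without-self : ∀ α (p : Poly n) → coeff (without α p) α ≈ 0#
    coeff-without-self α [] = refl
    coeff-without-self α ((c , β) ∷ p) with β ≟ α in eq
    ... | yes _ = coeff-without-self α p
    ... | no _ rewrite eq = trans (+-identityˡ _) (coeff-without-self α p)

    coeff-without : ∀ α (p : Poly n) {β} → α ≢ β → coeff (without α p) β ≈ coeff p β
    coeff-without α [] _ = refl
    coeff-without α ((c , γ) ∷ p) {β} α≢β with γ ≟ α
    ... | no _ = +-congˡ (coeff-without α p α≢β)
    ... | yes ≡.refl with γ ≟ β
    ...   | yes e = ⊥-elim (α≢β e)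
    ...   | no _  = trans (coeff-without α p α≢β) (sym (+-identityˡ _))

    without-zero : ∀ α (p : Poly n) → IsZero p → IsZero (without α p)
    without-zero α p h β with α ≟ β
    ... | yes ≡.refl = coeff-without-self α p
    ... | no α≢β     = trans (coeff-without α p α≢β) (h β)

    head-removed : ∀ c α (p : Poly n) → without α ((c , α) ∷ p) ≡ without α p
    head-removed c α p = Listₚ.filter-reject (λ t → ¬? (proj₂ t ≟ α)) (λ h → h ≡.refl)

  -- A zero polynomial may be a nonempty list whose like terms cancel. Collecting all terms with the
  -- first exponent splits off a vanishing coefficient and leaves a strictly shorter list, still
  -- zero.
  zero-poly : ∀ (p : Poly n) → IsZero p → p ~ []
  zero-poly p h x = go (List.length p) p ℕₚ.≤-refl h
    where
    -- The recursive call is on a filtered list, which is not a structural part of p; m bounds the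
    -- length.
    go : ∀ m p → List.length p ℕ.≤ m → IsZero p → ⟦ p ⟧ x ≈ 0#
    go m [] _ _ = refl
    go (suc m) p@((c , α) ∷ p′) (s≤s le) h = begin
      ⟦ p ⟧ x                                     ≈⟨ collect α p x ⟩
      coeff p α * monomial α x + ⟦ without α p ⟧ x ≈⟨ +-cong (trans (*-congʳ (h α)) (zeroˡ _))
                                                       (reflexive (≡.cong (λ q → ⟦ q ⟧ x) (head-removed c α p′))) ⟩
      0# + ⟦ without α p′ ⟧ x                     ≈⟨ +-identityˡ _ ⟩
      ⟦ without α p′ ⟧ x                          ≈⟨ go m (without α p′) (ℕₚ.≤-trans (Listₚ.length-filter _ p′) le)
                                                       (≡.subst IsZero (head-removed c α p′) (without-zero α p h)) ⟩
      0#                                          ∎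

-- Hessians, lineality, and the assembly of the theorem.

module Main (𝕜 : CompleteOrderedField) where

  open OrderedField 𝕜
  open QuadraticForm 𝕜
  open Hyperbolic 𝕜
  open Perron 𝕜
  open Polynomial 𝕜
  open Lorentzian 𝕜 hiding (ℝ; _≈_; _+_; _*_; -_; _-_; 0#; 1#; _<_; _≤_; semiring)
  open RawSemiringOps (Semiring.rawSemiring semiring) using (product)

  private
    variable
      n : ℕ

  dot-*ᵥ-≈ : {M N : Matrix n} → (∀ i j → M i j ≈ N i j) → ∀ x y → dot x (M *ᵥ y) ≈ dot x (N *ᵥ y)
  dot-*ᵥ-≈ M≈N x y = sum-cong-≋ (λ i → *-congˡ (sum-cong-≋ (λ j → *-congʳ (M≈N i j))))

  quad-≈ : {M N : Matrix n} → (∀ i j → M i j ≈ N i j) → ∀ x → quad M x ≈ quad N x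
  quad-≈ M≈N x = dot-*ᵥ-≈ M≈N x x

  product-cong : ∀ {m} {s t : Vector ℝ m} → (∀ i → s i ≈ t i) → product s ≈ product t
  product-cong {zero}  h = refl
  product-cong {suc m} h = *-cong (h zero) (product-cong (λ i → h (suc i)))

  nonnegativeOffDiagonal-≈ : {M N : Matrix n} → (∀ i j → M i j ≈ N i j) →
    NonnegativeOffDiagonal M → NonnegativeOffDiagonal N
  nonnegativeOffDiagonal-≈ M≈N h i j i≢j = ≤-respʳ (M≈N i j) (h i j i≢j)

  irreducible-≈ : {M N : Matrix n} → (∀ i j → M i j ≈ N i j) → Irreducible M → Irreducible N
  irreducible-≈ M≈N h i j i≢j = let ℓ , s , s₀ , s₁ , steps , pos = h i j i≢j in
    ℓ , s , s₀ , s₁ , steps , <-respʳ (product-cong (λ k → M≈N (s (inject₁ k)) (s (suc k)))) pos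

  ⟦DD⟧ : ∀ u v (p : Poly n) x → ⟦ D u (D v p) ⟧ x ≈ dot u (hessian p x *ᵥ v)
  ⟦DD⟧ u v p x = trans (⟦D⟧ u (D v p) x) (sum-cong-≋ (λ i → *-congˡ
    (trans (⟦∂D⟧ i v p x) (sum-cong-≋ (λ j → *-comm (v j) (⟦ ∂ i (∂ j p) ⟧ x))))))

  directional-gram : Poly n → Matrix n
  directional-gram p = gram (λ x y → constant (D x (D y p)))

  -- Irreducibility is given for Hessians, whereas condition (H) concerns the Gram matrix of
  -- directional derivatives; this identifies the two.
  gram-hessian : ∀ (p : Poly n) i j → directional-gram p i j ≈ hessian p 0⃗ i j
  gram-hessian p i j = trans (D-basis i (D (basis j) p) 0⃗)
    (∂-cong i {D (basis j) p} {∂ j p} (D-basis j p) 0⃗)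

  hessian-sym : ∀ (p : Poly n) x → Symmetric (hessian p x)
  hessian-sym p x i j = ∂-comm i j p x

  gram-sym : ∀ (p : Poly n) → Symmetric (directional-gram p)
  gram-sym p i j = trans (gram-hessian p i j) (trans (hessian-sym p 0⃗ i j) (sym (gram-hessian p j i)))

  quad-gram : ∀ (p : Poly n) v → constant (D v (D v p)) ≈ quad (directional-gram p) v
  quad-gram p v = trans (⟦DD⟧ v v p 0⃗) (quad-≈ (λ i j → sym (gram-hessian p i j)) v)

  -- A point of the cone within ε/t of x, scaled by t, is within ε of t x. The target z is kept
  -- separate from `t ⊙ x` so that the lemma also applies to the negative of a scaled vector.
  closure-scale : {C : Pred (ℝ^ n) 0ℓ} → IsCone C → ∀ {t} → 0# < t →
                  ∀ {x z} → z ≋ t ⊙ x → Closure C x → Closure C z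
  closure-scale cone {t} t>0 {x} {z} z≋tx cl ε ε>0 = rescale (recip t>0)
    where
    lower : ∀ r → t * r ≈ 1# → ∀ a b z → z ≈ t * a → t * (b - (a - ε * r)) ≈ t * b - (z - ε)
    lower r tr≈1 a b z e = begin
      t * (b - (a - ε * r))          ≈⟨ solve 5 (λ t b a e r → t :* (b :- (a :- e :* r)) := t :* b :- (t :* a :- (t :* r) :* e)) refl t b a ε r ⟩
      t * b - (t * a - (t * r) * ε)  ≈⟨ +-congˡ (-‿cong (+-cong (sym e) (-‿cong (trans (*-congʳ tr≈1) (*-identityˡ ε))))) ⟩
      t * b - (z - ε)                ∎
    upper : ∀ r → t * r ≈ 1# → ∀ a b z → z ≈ t * a → t * ((a + ε * r) - b) ≈ (z + ε) - t * b
    upper r tr≈1 a b z e = begin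
      t * ((a + ε * r) - b)          ≈⟨ solve 5 (λ t b a e r → t :* ((a :+ e :* r) :- b) := (t :* a :+ (t :* r) :* e) :- t :* b) refl t b a ε r ⟩
      (t * a + (t * r) * ε) - t * b  ≈⟨ +-congʳ (+-cong (sym e) (trans (*-congʳ tr≈1) (*-identityˡ ε))) ⟩
      (z + ε) - t * b                ∎
    rescale : ∃[ r ] 0# < r × t * r ≈ 1# → ∃[ y ] _ × Near ε z y
    rescale (r , r>0 , tr≈1) = let y , Cy , near = cl (ε * r) (*-pos ε>0 r>0) in
      t ⊙ y , cone y t Cy t>0 , λ i →
        <-via (*-pos t>0 (<-diff (proj₁ (near i)))) (lower r tr≈1 (x i) (y i) (z i) (z≋tx i)) ,
        <-via (*-pos t>0 (<-diff (proj₂ (near i)))) (upper r tr≈1 (x i) (y i) (z i) (z≋tx i))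

  -- Differentiating along w requires invariance of f under all t w with t > 0, not under w alone.
  lineality-scale : {C : Pred (ℝ^ n) 0ℓ} → IsCone C → ∀ {t} → 0# < t →
                    ∀ {w} → Lineality C w → Lineality C (t ⊙ w)
  lineality-scale cone {t} t>0 {w} (l , r) =
    closure-scale cone t>0 (λ _ → refl) l ,
    closure-scale cone t>0 (λ i → solve 2 (λ t w → :- (t :* w) := t :* (:- w)) refl t (w i)) r

  module Slices {k} (f : Poly n) (ws : Vector (ℝ^ n) k) where

    h : Poly n
    h = D* ws f

    T : Fin n → Matrix n
    T l = hessian (D* ws (∂ l f)) 0⃗

    -- Moving the partial derivative outside `D*` exhibits T as the array of third partial
    -- derivatives of one polynomial, which is why it is totally symmetric.
    T-∂ : ∀ l i j → T l i j ≈ ⟦ ∂ i (∂ j (∂ l h)) ⟧ 0⃗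
    T-∂ l i j = sym (∂-cong i {∂ j (∂ l h)} {∂ j (D* ws (∂ l f))}
      (∂-cong j {∂ l h} {D* ws (∂ l f)} (∂-D*-comm l ws f)) 0⃗)

    T-sym₂ : ∀ i j l → T i j l ≈ T i l j
    T-sym₂ i j l = hessian-sym (D* ws (∂ i f)) 0⃗ j l

    swap-inner : ∀ i j l → ⟦ ∂ i (∂ j (∂ l h)) ⟧ 0⃗ ≈ ⟦ ∂ i (∂ l (∂ j h)) ⟧ 0⃗
    swap-inner i j l = ∂-cong i {∂ j (∂ l h)} {∂ l (∂ j h)} (∂-comm j l h) 0⃗

    T-sym₁ : ∀ i j l → T i j l ≈ T j i l
    T-sym₁ i j l = begin
      T i j l                    ≈⟨ T-∂ i j l ⟩
      ⟦ ∂ j (∂ l (∂ i h)) ⟧ 0⃗    ≈⟨ swap-inner j l i ⟩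
      ⟦ ∂ j (∂ i (∂ l h)) ⟧ 0⃗    ≈⟨ ∂-comm j i (∂ l h) 0⃗ ⟩
      ⟦ ∂ i (∂ j (∂ l h)) ⟧ 0⃗    ≈⟨ swap-inner i j l ⟩
      ⟦ ∂ i (∂ l (∂ j h)) ⟧ 0⃗    ≈⟨ T-∂ j i l ⟨
      T j i l                    ∎

    hessian-D : ∀ u i j → hessian (D u h) 0⃗ i j ≈ sum (λ l → u l * T l i j)
    hessian-D u i j = begin
      ⟦ ∂ i (∂ j (D u h)) ⟧ 0⃗
        ≈⟨ ∂-cong i {∂ j (D u h)} {D u (∂ j h)} (∂-D-comm j u h) 0⃗ ⟩
      ⟦ ∂ i (D u (∂ j h)) ⟧ 0⃗
        ≈⟨ ⟦∂D⟧ i u (∂ j h) 0⃗ ⟩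
      sum (λ l → u l * ⟦ ∂ i (∂ l (∂ j h)) ⟧ 0⃗)
        ≈⟨ sum-cong-≋ (λ l → *-congˡ (trans (swap-inner i l j) (sym (T-∂ l i j)))) ⟩
      sum (λ l → u l * T l i j) ∎

    hessian-D-invariant : ∀ {w} → D w f ~ [] → ∀ i j → sum (λ l → w l * T l i j) ≈ 0#
    hessian-D-invariant {w} Dwf~0 i j = trans (sym (hessian-D w i j))
      (∂-zero i {∂ j (D w h)} (∂-zero j {D w h} λ x →
        trans (D-D*-comm w ws f x) (D*-zero ws {D w f} Dwf~0 x)) 0⃗)

    hessian-split : ∀ {v p w} → v ≋ p ⊕ w → D w f ~ [] →
      ∀ i j → hessian (D v h) 0⃗ i j ≈ sum (λ l → p l * T l i j)
    hessian-split {v} {p} {w} v≋p+w Dwf~0 i j = begin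
      hessian (D v h) 0⃗ i j
        ≈⟨ hessian-D v i j ⟩
      sum (λ l → v l * T l i j)
        ≈⟨ sum-cong-≋ (λ l → trans (*-congʳ (v≋p+w l)) (distribʳ (T l i j) (p l) (w l))) ⟩
      sum (λ l → p l * T l i j + w l * T l i j)
        ≈⟨ ∑-distrib-+ (λ l → p l * T l i j) (λ l → w l * T l i j) ⟩
      sum (λ l → p l * T l i j) + sum (λ l → w l * T l i j)
        ≈⟨ +-congˡ (hessian-D-invariant Dwf~0 i j) ⟩
      sum (λ l → p l * T l i j) + 0#
        ≈⟨ +-identityʳ _ ⟩
      sum (λ l → p l * T l i j) ∎

  -- Effectivity is needed for the first vector v only: writing v = p + w with p
  -- positive and w in the lineality space, A is the combination of the Hessians
  -- of the partial derivatives of f with coefficients p.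
  lorentzian-hessian : ∀ {k} (f : Poly n) (C : Pred (ℝ^ n) 0ℓ) → IsCone C → Effective C →
    (∀ x w → Lineality C w → ⟦ f ⟧ (x ⊕ w) ≈ ⟦ f ⟧ x) →
    (vs : Vector (ℝ^ n) (suc k)) → (∀ i → C (vs i)) →
    (∀ p → C p → 0# < constant (D p (D p (D* vs f)))) →
    Irreducible (hessian (D* vs f) 0⃗) → NonnegativeOffDiagonal (hessian (D* vs f) 0⃗) →
    (∀ i → IsLorentzian C (suc (suc k)) (∂ i f)) →
    ExactlyOnePositiveEigenvalue (directional-gram (D* vs f))
  lorentzian-hessian {n} {k} f C cone effective invariant vs vs∈C pos irr nonneg lor =
    decompose (Equivalence.to (effective (vs zero)) (vs∈C zero))
    where
    open Slices f (Vector.tail vs)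
    A : Matrix n
    A = directional-gram (D* vs f)
    hessian≈A : ∀ i j → hessian (D* vs f) 0⃗ i j ≈ A i j
    hessian≈A i j = sym (gram-hessian (D* vs f) i j)
    A-irr : Irreducible A
    A-irr = irreducible-≈ hessian≈A irr

    decompose : ∃[ p ] ∃[ w ] (C p × Positive p) × Lineality C w × vs zero ≋ p ⊕ w →
                ExactlyOnePositiveEigenvalue A
    decompose (p , w , (Cp , p>0) , w∈L , v≋p+w) =
      lorentzian-from-slices (gram-sym (D* vs f)) (nonnegativeOffDiagonal-≈ hessian≈A nonneg) A-irr
        p>0 Ap>0 T T-sym₁ T-sym₂ A≈T Tp>0 reverse
      where
      Dwf~0 : D w f ~ []
      Dwf~0 = D-zero w f (λ x t t>0 → invariant x (t ⊙ w) (lineality-scale cone t>0 w∈L))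
      A≈T : ∀ i j → A i j ≈ sum (λ l → p l * T l i j)
      A≈T i j = trans (gram-hessian (D* vs f) i j) (hessian-split v≋p+w Dwf~0 i j)
      Ap>0 : 0# < quad A p
      Ap>0 = <-respʳ (quad-gram (D* vs f) p) (pos p Cp)

      -- With p in the first two places, positivity for ∂_i f says T_i(p) > 0. Condition (H)
      -- discards these two places and speaks of T_i itself.
      us : Vector (ℝ^ n) (suc (suc k))
      us = p Vector.∷ (p Vector.∷ Vector.tail vs)
      us∈C : ∀ i → C (us i)
      us∈C zero          = Cp
      us∈C (suc zero)    = Cp
      us∈C (suc (suc i)) = vs∈C (suc i)

      conditions : ∀ i → ConditionP (suc (suc k)) us (∂ i f) × ConditionH (suc (suc k)) us (∂ i f)
      conditions i = select (proj₂ (lor i))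
        where
        -- If ∂_i f = 0 then T_i = 0, and by symmetry A_ij = Σ p_l (T_i)_lj vanishes for all j.
        zero-row : IsZero (∂ i f) → ∀ j → A i j ≈ 0#
        zero-row z j = trans (A≈T i j) (sum-0 (λ l → trans (*-congˡ (trans (T-sym₁ l i j)
          (∂-zero l {∂ j (D* (Vector.tail vs) (∂ i f))} (∂-zero j {D* (Vector.tail vs) (∂ i f)}
            (D*-zero (Vector.tail vs) {∂ i f} (zero-poly (∂ i f) z))) 0⃗))) (zeroʳ (p l))))
        select : IsZero (∂ i f) ⊎ (∀ (us : Vector (ℝ^ n) (suc (suc k))) → (∀ j → C (us j)) →
                   ConditionP (suc (suc k)) us (∂ i f) × ConditionH (suc (suc k)) us (∂ i f)) →
                 ConditionP (suc (suc k)) us (∂ i f) × ConditionH (suc (suc k)) us (∂ i f)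
        select (inj₁ z) = ⊥-elim (irreducible-row-nonzero A-irr Ap>0 i (zero-row z))
        select (inj₂ g) = g us us∈C

      G : Fin n → Matrix n
      G i = directional-gram (D* (Vector.tail vs) (∂ i f))
      G≈T : ∀ l i j → G l i j ≈ T l i j
      G≈T l i j = gram-hessian (D* (Vector.tail vs) (∂ l f)) i j
      Gp>0 : ∀ l → 0# < quad (G l) p
      Gp>0 l = <-respʳ (quad-gram (D* (Vector.tail vs) (∂ l f)) p) (proj₁ (conditions l))
      Tp>0 : ∀ l → 0# < quad (T l) p
      Tp>0 l = <-respʳ (quad-≈ (G≈T l) p) (Gp>0 l)
      reverse : ∀ l x → quad (T l) x * quad (T l) p ≤ dot x (T l *ᵥ p) * dot x (T l *ᵥ p)
      reverse l x = ≤-respˡ (*-cong (quad-≈ (G≈T l) x) (quad-≈ (G≈T l) p))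
        (≤-respʳ (*-cong (dot-*ᵥ-≈ (G≈T l) x p) (dot-*ᵥ-≈ (G≈T l) x p))
          (reverse-cauchy-schwarz (gram-sym (D* (Vector.tail vs) (∂ l f))) (proj₂ (conditions l)) (Gp>0 l) x))

proposition2p4 : (𝕜 : CompleteOrderedField) →
    let open Lorentzian 𝕜 in
    (n d : ℕ) → 3 ≤ⁿ d →
    (f : Poly n) → Homogeneous d f →
    (C : Pred (ℝ^ n) 0ℓ) → IsOpenConvexCone C → Effective C →
    (∀ x w → Lineality C w → ⟦ f ⟧ (x ⊕ w) ≈ ⟦ f ⟧ x) →
    (∀ (vs : Vector (ℝ^ n) d) → (∀ k → C (vs k)) → 0# < constant (D* vs f)) →
    (∀ (vs : Vector (ℝ^ n) (d ∸ 2)) → (∀ k → C (vs k)) →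
      ∀ x → Irreducible (hessian (D* vs f) x)
          × NonnegativeOffDiagonal (hessian (D* vs f) x)) →
    (∀ (i : Fin n) → IsLorentzian C (d ∸ 1) (∂ i f)) →
    IsLorentzian C d f
-- The bound d ≥ 3 supplies v₃, the vector that effectivity decomposes.
proposition2p4 𝕜 n (suc (suc (suc k))) (s≤s (s≤s (s≤s _))) f
  homogeneous C C-cone effective invariant positive hess lorentzian =
  homogeneous , inj₂ λ vs vs∈C → positive vs vs∈C , condition-H vs vs∈C
  where
  open Lorentzian 𝕜
  open Main 𝕜

  condition-H : (vs : Vector (ℝ^ n) (suc (suc (suc k)))) → (∀ i → C (vs i)) →
                ConditionH (suc (suc (suc k))) vs f
  condition-H vs vs∈C = lorentzian-hessian f C (IsOpenConvexCone.isCone C-cone) effective invariant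
    us (λ i → vs∈C (suc (suc i)))
    -- Positivity of f at p, p, v₃, ..., v_d is the inequality A(p) > 0.
    (λ p Cp → positive (p Vector.∷ (p Vector.∷ us))
      λ { zero → Cp ; (suc zero) → Cp ; (suc (suc i)) → vs∈C (suc (suc i)) })
    -- The Hessian is taken at the origin because `constant` evaluates there.
    (proj₁ (hess us (λ i → vs∈C (suc (suc i))) 0⃗))
    (proj₂ (hess us (λ i → vs∈C (suc (suc i))) 0⃗))
    lorentzian
    where
    us : Vector (ℝ^ n) (suc k)
    us = Vector.drop 2 vs
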